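{- Fix any $0 < \epsilon \leq 1$ and let $\beta$ and $\beta^-$ be integers with $\beta \geq 50/\epsilon$ and $\beta^- \geq (1-\frac{\epsilon}{10})\beta$. Then for any (finite, undirected) graph $G$ and any $(\beta, \beta^-)$-EDCS $H$ of $G$, it holds that $\mu(H) \geq \big(\frac{2}{3} - \epsilon\big) \cdot \mu(G)$.
   Context: For a graph $K$, $\mu(K)$ denotes the size of a maximum matching of $K$, $\deg_K(v)$ is the degree of vertex $v$ in $K$. Let $G=(V,E)$ be a graph and let $\beta > \beta^- \geq 1$ be integers. A subgraph $H=(V,E_H)$ of $G$ (on the same vertex set) is a $(\beta,\beta^-)$-EDCS of $G$ if: (P1) for every edge $(u,v) \in E_H$, $\deg_H(u)+\deg_H(v) \leq \beta$; and (P2) for every edge $(u,v) \in E \setminus E_H$, $\deg_H(u)+\deg_H(v) \geq \beta^-$. -}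

module Defs where

open import Data.Nat using (ℕ; _+_; _≤_; _≥_)
open import Data.Bool using (Bool; true; false; if_then_else_)
open import Data.Fin using (Fin)
open import Data.List using (List; []; _∷_; length; map; concatMap; allFin)
open import Data.Nat.ListAction using (sum)
open import Data.List.Relation.Unary.All using (All)
open import Data.List.Relation.Unary.Unique.Propositional using (Unique)
open import Data.Product using (_×_; _,_; Σ)
open import Relation.Binary.PropositionalEquality using (_≡_)

record Graph (n : ℕ) : Set where
  field
    adj    : Fin n → Fin n → Bool
    sym    : ∀ u v → adj u v ≡ adj v u
    irrefl : ∀ u → adj u u ≡ false
open Graph public

_⊆G_ : ∀ {n} → Graph n → Graph n → Set
H ⊆G G = ∀ u v → adj H u v ≡ true → adj G u v ≡ true

deg : ∀ {n} → Graph n → Fin n → ℕ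
deg {n} K v = sum (map (λ w → if adj K v w then 1 else 0) (allFin n))

endpoints : ∀ {n} → List (Fin n × Fin n) → List (Fin n)
endpoints = concatMap (λ e → Data.Product.proj₁ e ∷ Data.Product.proj₂ e ∷ [])

IsMatching : ∀ {n} → Graph n → List (Fin n × Fin n) → Set
IsMatching K M = All (λ e → adj K (Data.Product.proj₁ e) (Data.Product.proj₂ e) ≡ true) M
                 × Unique (endpoints M)

IsMaxMatchingSize : ∀ {n} → Graph n → ℕ → Set
IsMaxMatchingSize {n} K k =
  Σ (List (Fin n × Fin n)) (λ M → IsMatching K M × length M ≡ k)
  × (∀ M → IsMatching K M → length M ≤ k)

IsEDCS : ∀ {n} → Graph n → Graph n → ℕ → ℕ → Set
IsEDCS G H β β⁻ =
  H ⊆G G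
  × (∀ u v → adj H u v ≡ true → deg H u + deg H v ≤ β)
  × (∀ u v → adj G u v ≡ true → adj H u v ≡ false → deg H u + deg H v ≥ β⁻)

{-# OPTIONS --safe #-}
module Submission where

-- Removing vertices that every maximum matching covers, one at a time, one reaches a set A with
-- μ(H) = |A| + k such that every vertex of H ∖ A is missed by one of its maximum matchings (of size k).
-- There, "no maximum matching misses both u and v" is an equivalence relation (Gallai), edges stay
-- inside its classes, and a maximum matching misses at most one vertex of each class.  Hence, with N the
-- set of vertices in classes of size at least 2 and L that of vertices in classes of size at least 6,
-- 4|N| + |L| ≤ 12k.
--
-- Let M be a maximum matching of G and S the set of vertices outside A, in singleton classes, that M
-- matches outside A.  Then 2|M| ≤ 2|A| + |N| + |S|, so it suffices that |S| ≤ |A| + |L|/4 up to an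
-- error of order ε(|S| + |N|).  Summing deg(u) + deg(v) ≤ β over the edges of H not inside A gives
-- 4 ∑ deg(v)² ≤ |A|β² + 2β ∑ deg′(v), where v ranges over the vertices outside A and deg′ is the degree
-- in H ∖ A.  A vertex of S has deg′ = 0, so its edge of M is not in H and the degree sum of that edge is
-- at least β⁻; the bound on |S| then follows by comparing the two sides along each edge of M.
--
-- The existence of A and of the classes is proved under a double negation, which the decidable final
-- inequality absorbs.

open import Defs
import Data.Nat.Properties as ℕ
open import Relation.Binary.PropositionalEquality as ≡ using (_≡_; _≢_; refl; cong; cong₂; subst; subst₂)

module EDCS where

  open import Algebra.Properties.Semiring.Sum ℕ.+-*-semiring using (sum; sum-cong-≗; ∑-distrib-+; ∑-comm; sum-permute; *-distribˡ-sum)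
  open import Data.Bool using (Bool; true; false; if_then_else_; not; _∧_; _∨_)
  open import Data.Empty using (⊥; ⊥-elim)
  open import Data.Fin using (Fin; zero; suc)
  open import Data.Fin.Permutation using (permutation)
  open import Data.Fin.Properties as Fin using (_≟_; any?; all?; ¬∀⟶∃¬)
  open import Data.List as List using (List; []; _∷_; length)
  open import Data.List.Properties using (map-tabulate)
  open import Data.List.Relation.Unary.All as All using (All; []; _∷_)
  open import Data.List.Relation.Unary.AllPairs using ([]; _∷_)
  open import Data.Nat using (ℕ; zero; suc; _+_; _*_; _∸_; _≤_; _<_; _≤?_; z≤n; s≤s; s≤s⁻¹; NonZero)
  import Data.Nat.ListAction as ListAction
  open import Data.Nat.Properties hiding (_≟_)
  open import Data.Nat.Tactic.RingSolver using (solve-∀)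
  open import Data.Product using (∃-syntax; _×_; _,_; proj₁; proj₂)
  open import Data.Sum using (_⊎_; inj₁; inj₂)
  open import Function using (_∘_; id)
  open import Relation.Nullary using (¬_; Dec; yes; no; does; contradiction; ¬?; _×-dec_)
  open import Relation.Nullary.Decidable using (¬¬-excluded-middle; decidable-stable)

  private variable n : ℕ

  -- Finite sums and indicators

  𝟙 : Bool → ℕ
  𝟙 b = if b then 1 else 0

  𝟙≤1 : ∀ b → 𝟙 b ≤ 1
  𝟙≤1 true  = s≤s z≤n
  𝟙≤1 false = z≤n

  sum-mono : {f g : Fin n → ℕ} → (∀ i → f i ≤ g i) → sum f ≤ sum g
  sum-mono {zero}  f≤g = z≤n
  sum-mono {suc n} f≤g = +-mono-≤ (f≤g zero) (sum-mono (f≤g ∘ suc))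

  sum-zero : (f : Fin n → ℕ) → (∀ i → f i ≡ 0) → sum f ≡ 0
  sum-zero {zero}  f f≡0 = refl
  sum-zero {suc n} f f≡0 rewrite f≡0 zero = sum-zero (f ∘ suc) (f≡0 ∘ suc)

  term≤sum : (f : Fin n → ℕ) (i : Fin n) → f i ≤ sum f
  term≤sum f zero    = m≤m+n _ _
  term≤sum f (suc i) = ≤-trans (term≤sum (f ∘ suc) i) (m≤n+m _ _)

  two-terms≤sum : (f : Fin n → ℕ) (i j : Fin n) → i ≢ j → f i + f j ≤ sum f
  two-terms≤sum f zero    zero    i≢j = contradiction refl i≢j
  two-terms≤sum f zero    (suc j) i≢j = +-monoʳ-≤ (f zero) (term≤sum (f ∘ suc) j)
  two-terms≤sum f (suc i) zero    i≢j =
    ≤-trans (≤-reflexive (+-comm (f (suc i)) (f zero))) (+-monoʳ-≤ (f zero) (term≤sum (f ∘ suc) i))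
  two-terms≤sum f (suc i) (suc j) i≢j =
    ≤-trans (two-terms≤sum (f ∘ suc) i j (i≢j ∘ cong suc)) (m≤n+m _ _)

  sum-positive : (f : Fin n → ℕ) → 1 ≤ sum f → ∃[ i ] 1 ≤ f i
  sum-positive {suc n} f p with f zero in eq
  ... | suc _ = zero , subst (1 ≤_) (≡.sym eq) (s≤s z≤n)
  ... | zero  with i , q ← sum-positive (f ∘ suc) p = suc i , q

  sum-at-most-one : (f : Fin n → ℕ) → (∀ i → f i ≤ 1) →
    (∀ i j → 1 ≤ f i → 1 ≤ f j → i ≡ j) → sum f ≤ 1
  sum-at-most-one {zero}  f f≤1 uniq = z≤n
  sum-at-most-one {suc n} f f≤1 uniq with f zero in eq
  ... | zero  = sum-at-most-one (f ∘ suc) (f≤1 ∘ suc) 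
    (λ i j p q → Fin.suc-injective (uniq (suc i) (suc j) p q))
  ... | suc m = ≤-trans (≤-reflexive (≡.trans (cong (suc m +_) rest) (+-identityʳ (suc m))))
    (subst (_≤ 1) eq (f≤1 zero))
    where
    rest : sum (f ∘ suc) ≡ 0
    rest = sum-zero (f ∘ suc) λ i → n≤0⇒n≡0 (≮⇒≥ λ p →
      contradiction (uniq zero (suc i) (subst (1 ≤_) (≡.sym eq) (s≤s z≤n)) p) λ ())

  δ : Fin n → Fin n → ℕ
  δ i j = 𝟙 (does (i ≟ j))

  δ-refl : (i : Fin n) → δ i i ≡ 1
  δ-refl i with i ≟ i
  ... | yes _  = refl
  ... | no i≢i = contradiction refl i≢i

  δ-≢ : {i j : Fin n} → i ≢ j → δ i j ≡ 0
  δ-≢ {i = i} {j} i≢j with i ≟ j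
  ... | yes i≡j = contradiction i≡j i≢j
  ... | no _    = refl

  sum-δ : (i : Fin n) → sum (δ i) ≡ 1
  sum-δ i = ≤-antisym
    (sum-at-most-one (δ i) (λ j → 𝟙≤1 (does (i ≟ j))) (λ j k p q → ≡.trans (≡.sym (hit j p)) (hit k q)))
    (≤-trans (≤-reflexive (≡.sym (δ-refl i))) (term≤sum (δ i) i))
    where
    hit : ∀ j → 1 ≤ δ i j → i ≡ j
    hit j p with i ≟ j
    ... | yes i≡j = i≡j

  -- Accounts for the two ends of an edge that is added or dropped, and for the two vertices `u` and
  -- `v` in the exchange argument.
  sum-pair : (f : Fin n → ℕ) (a b : Fin n) → sum (λ w → f w + (δ a w + δ b w)) ≡ sum f + 2
  sum-pair f a b = begin
    sum (λ w → f w + (δ a w + δ b w))      ≡⟨ ∑-distrib-+ f _ ⟩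
    sum f + sum (λ w → δ a w + δ b w)      ≡⟨ cong (sum f +_) (∑-distrib-+ (δ a) (δ b)) ⟩
    sum f + (sum (δ a) + sum (δ b))        ≡⟨ cong (sum f +_) (cong₂ _+_ (sum-δ a) (sum-δ b)) ⟩
    sum f + 2                              ∎
    where open ≡.≡-Reasoning

  sum-involution : (f : Fin n → ℕ) (m : Fin n → Fin n) → (∀ i → m (m i) ≡ i) → sum (f ∘ m) ≡ sum f
  sum-involution f m inv = ≡.sym (sum-permute f (permutation m m inv inv))

  sum-*ˡ : (f : Fin n → ℕ) (c : ℕ) → sum (λ i → c * f i) ≡ c * sum f
  sum-*ˡ f c = ≡.sym (*-distribˡ-sum c f)

  deg≡sum : (K : Graph n) (v : Fin n) → deg K v ≡ sum (λ w → 𝟙 (adj K v w))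
  deg≡sum {n} K v = ≡.trans (cong ListAction.sum (map-tabulate id g)) (go g)
    where
    g : Fin n → ℕ
    g w = 𝟙 (adj K v w)
    go : ∀ {k} (h : Fin k → ℕ) → ListAction.sum (List.tabulate h) ≡ sum h
    go {zero}  h = refl
    go {suc k} h = cong (h zero +_) (go (h ∘ suc))

  -- Matchings as involutions

  record Matching (K : Graph n) : Set where
    field
      mate       : Fin n → Fin n
      involutive : ∀ v → mate (mate v) ≡ v
      edge       : ∀ v → mate v ≢ v → adj K v (mate v) ≡ true

    mate-injective : ∀ {v w} → mate v ≡ mate w → v ≡ w
    mate-injective {v} {w} p = ≡.trans (≡.sym (involutive v)) (≡.trans (cong mate p) (involutive w))

    mate-covered : ∀ {v} → mate v ≢ v → mate (mate v) ≢ mate v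
    mate-covered p q = p (mate-injective q)

    free covered : Fin n → ℕ
    free v    = δ (mate v) v
    covered v = 𝟙 (not (does (mate v ≟ v)))

    free+covered : ∀ v → free v + covered v ≡ 1
    free+covered v with mate v ≟ v
    ... | yes _ = refl
    ... | no _  = refl

    covered-yes : ∀ {v} → mate v ≢ v → covered v ≡ 1
    covered-yes {v} p with mate v ≟ v
    ... | yes q = contradiction q p
    ... | no _  = refl

    covered-no : ∀ {v} → mate v ≡ v → covered v ≡ 0
    covered-no {v} p with mate v ≟ v
    ... | yes _ = refl
    ... | no q  = contradiction p q

    -- Fixed points of `mate` are the missed vertices, so this is twice the number of edges; hence
    -- the factors 2 in later bounds.
    size : ℕ
    size = sum covered

  open Matching

  adj⇒≢ : (K : Graph n) {u v : Fin n} → adj K u v ≡ true → u ≢ v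
  adj⇒≢ K p refl with () ← ≡.trans (≡.sym p) (irrefl K _)

  empty : (K : Graph n) → Matching K
  empty K = record { mate = id ; involutive = λ _ → refl ; edge = λ v p → contradiction refl p }

  size-empty : (K : Graph n) → size (empty K) ≡ 0
  size-empty K = sum-zero (covered (empty K)) λ v → covered-no (empty K) {v} refl

  module _ {K : Graph n} where

    covered-cong : (M M′ : Matching K) {v : Fin n} → mate M v ≡ mate M′ v → covered M v ≡ covered M′ v
    covered-cong M M′ {v} p = cong (λ w → 𝟙 (not (does (w ≟ v)))) p

    module Drop (M : Matching K) (v : Fin n) where

      dropMate : Fin n → Fin n
      dropMate w with w ≟ v | w ≟ mate M v
      ... | yes _ | _     = w
      ... | no _  | yes _ = w
      ... | no _  | no _  = mate M w

      dropMate-v : dropMate v ≡ v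
      dropMate-v with v ≟ v | v ≟ mate M v
      ... | yes _ | _     = refl
      ... | no _  | yes _ = refl
      ... | no ¬p | no _  = contradiction refl ¬p

      dropMate-mv : dropMate (mate M v) ≡ mate M v
      dropMate-mv with mate M v ≟ v | mate M v ≟ mate M v
      ... | yes _ | _     = refl
      ... | no _  | yes _ = refl
      ... | no _  | no ¬p = contradiction refl ¬p

      dropMate-else : ∀ {w} → w ≢ v → w ≢ mate M v → dropMate w ≡ mate M w
      dropMate-else {w} p q with w ≟ v | w ≟ mate M v
      ... | yes r | _     = contradiction r p
      ... | no _  | yes r = contradiction r q
      ... | no _  | no _  = refl

      -- Splitting along these equations, rather than on the `with` of `dropMate`, lets later proofs
      -- rewrite by the three computation rules above.
      dropMate-cases : ∀ w → (w ≡ v ⊎ w ≡ mate M v) ⊎ (w ≢ v × w ≢ mate M v)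
      dropMate-cases w with w ≟ v | w ≟ mate M v
      ... | yes p | _     = inj₁ (inj₁ p)
      ... | no _  | yes p = inj₁ (inj₂ p)
      ... | no p  | no q  = inj₂ (p , q)

      drop : Matching K
      drop .mate = dropMate
      drop .involutive w with dropMate-cases w
      ... | inj₁ (inj₁ refl) = ≡.trans (cong dropMate dropMate-v) dropMate-v
      ... | inj₁ (inj₂ refl) = ≡.trans (cong dropMate dropMate-mv) dropMate-mv
      -- The partner of such a `w` lies off the dropped edge as well, because `mate M` exchanges the
      -- two ends of that edge.
      ... | inj₂ (p , q)     = ≡.trans (cong dropMate (dropMate-else p q)) (≡.trans
        (dropMate-else (λ r → q (≡.trans (≡.sym (involutive M w)) (cong (mate M) r)))
                       (λ r → p (mate-injective M r)))
        (involutive M w))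
      drop .edge w r with dropMate-cases w
      ... | inj₁ (inj₁ refl) = contradiction dropMate-v r
      ... | inj₁ (inj₂ refl) = contradiction dropMate-mv r
      ... | inj₂ (p , q) rewrite dropMate-else p q = edge M w r

      size-drop : mate M v ≢ v → size M ≡ size drop + 2
      size-drop mv≢v = ≡.trans (sum-cong-≗ pointwise) (sum-pair (covered drop) v (mate M v))
        where
        pointwise : ∀ w → covered M w ≡ covered drop w + (δ v w + δ (mate M v) w)
        pointwise w with dropMate-cases w
        ... | inj₁ (inj₁ refl) rewrite covered-yes M mv≢v | covered-no drop dropMate-v
                                     | δ-refl v | δ-≢ mv≢v = refl
        ... | inj₁ (inj₂ refl) rewrite covered-yes M (mate-covered M mv≢v) | covered-no drop dropMate-mv
                                     | δ-refl (mate M v) | δ-≢ (mv≢v ∘ ≡.sym) = refl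
        ... | inj₂ (p , q) rewrite δ-≢ (p ∘ ≡.sym) | δ-≢ (q ∘ ≡.sym) | +-identityʳ (covered drop w) =
          covered-cong M drop (≡.sym (dropMate-else p q))

    module Join (M : Matching K) (a b : Fin n) (ab : adj K a b ≡ true)
                (fa : mate M a ≡ a) (fb : mate M b ≡ b) where

      joinMate : Fin n → Fin n
      joinMate w with w ≟ a | w ≟ b
      ... | yes _ | _     = b
      ... | no _  | yes _ = a
      ... | no _  | no _  = mate M w

      a≢b : a ≢ b
      a≢b = adj⇒≢ K ab

      joinMate-a : joinMate a ≡ b
      joinMate-a with a ≟ a | a ≟ b
      ... | yes _ | _     = refl
      ... | no ¬p | _     = contradiction refl ¬p

      joinMate-b : joinMate b ≡ a
      joinMate-b with b ≟ a | b ≟ b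
      ... | yes p | _     = p
      ... | no _  | yes _ = refl
      ... | no _  | no ¬p = contradiction refl ¬p

      joinMate-else : ∀ {w} → w ≢ a → w ≢ b → joinMate w ≡ mate M w
      joinMate-else {w} p q with w ≟ a | w ≟ b
      ... | yes r | _     = contradiction r p
      ... | no _  | yes r = contradiction r q
      ... | no _  | no _  = refl

      joinMate-cases : ∀ w → (w ≡ a ⊎ w ≡ b) ⊎ (w ≢ a × w ≢ b)
      joinMate-cases w with w ≟ a | w ≟ b
      ... | yes p | _     = inj₁ (inj₁ p)
      ... | no _  | yes p = inj₁ (inj₂ p)
      ... | no p  | no q  = inj₂ (p , q)

      join : Matching K
      join .mate = joinMate
      join .involutive w with joinMate-cases w
      ... | inj₁ (inj₁ refl) = ≡.trans (cong joinMate joinMate-a) joinMate-b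
      ... | inj₁ (inj₂ refl) = ≡.trans (cong joinMate joinMate-b) joinMate-a
      ... | inj₂ (p , q)     = ≡.trans (cong joinMate (joinMate-else p q)) (≡.trans
        (joinMate-else (λ r → p (mate-injective M (≡.trans r (≡.sym fa))))
                       (λ r → q (mate-injective M (≡.trans r (≡.sym fb)))))
        (involutive M w))
      join .edge w r with joinMate-cases w
      ... | inj₁ (inj₁ refl) rewrite joinMate-a = ab
      ... | inj₁ (inj₂ refl) rewrite joinMate-b = ≡.trans (sym K w a) ab
      ... | inj₂ (p , q) rewrite joinMate-else p q = edge M w r

      size-join : size join ≡ size M + 2
      size-join = ≡.trans (sum-cong-≗ pointwise) (sum-pair (covered M) a b)
        where
        pointwise : ∀ w → covered join w ≡ covered M w + (δ a w + δ b w)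
        pointwise w with joinMate-cases w
        ... | inj₁ (inj₁ refl)
            rewrite covered-yes join (λ p → a≢b (≡.trans (≡.sym p) joinMate-a)) | covered-no M fa
                  | δ-refl a | δ-≢ (a≢b ∘ ≡.sym) = refl
        ... | inj₁ (inj₂ refl)
            rewrite covered-yes join (λ p → a≢b (≡.trans (≡.sym joinMate-b) p)) | covered-no M fb
                  | δ-refl b | δ-≢ a≢b = refl
        ... | inj₂ (p , q) rewrite δ-≢ (p ∘ ≡.sym) | δ-≢ (q ∘ ≡.sym) | +-identityʳ (covered M w) =
          covered-cong join M (joinMate-else p q)

    open Drop using (drop; dropMate-v; dropMate-mv; size-drop)
    open Join using (join; joinMate-else; size-join)

    double-suc : ∀ l → 2 * l + 2 ≡ 2 * suc l
    double-suc = solve-∀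

    -- Edges are dropped one at a time, by recursion on a bound `s` for the size. The recursion
    -- carries along that every listed endpoint is covered, which makes it differ from both ends of
    -- the edge just dropped.
    toList : (M : Matching K) → ∃[ L ] IsMatching K L × size M ≡ 2 * length L
    toList M = let L , isM , eq , _ = go (size M) M ≤-refl in L , isM , eq
      where
      go : ∀ s (M : Matching K) → size M ≤ s →
           ∃[ L ] IsMatching K L × size M ≡ 2 * length L × All (λ w → mate M w ≢ w) (endpoints L)
      go s M bound with size M in eq
      ... | zero = [] , ([] , []) , refl , []
      go (suc s) M (s≤s bound) | suc t
        with v , p ← sum-positive (covered M) (subst (1 ≤_) (≡.sym eq) (s≤s z≤n))
        = (v , mate M v) ∷ L , (edge M v mv≢v ∷ proj₁ isM , (mv≢v ∘ ≡.sym ∷ All.map differs-v inside) ∷ All.map differs-mv inside ∷ proj₂ isM)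
          , ≡.trans (≡.sym eq) (≡.trans size-M (≡.trans (cong (_+ 2) size-L) (double-suc (length L))))
          , mv≢v ∷ mate-covered M mv≢v ∷ All.map coveredM inside
        where
        mv≢v : mate M v ≢ v
        mv≢v q with () ← subst (1 ≤_) (covered-no M q) p
        M′ : Matching K
        M′ = drop M v
        size-M : size M ≡ size M′ + 2
        size-M = size-drop M v mv≢v
        smaller : size M′ ≤ s
        smaller = ≤-trans (n≤1+n _) (≤-trans (≤-reflexive (suc-injective
          (≡.trans (+-comm 2 (size M′)) (≡.trans (≡.sym size-M) eq)))) bound)
        rec : ∃[ L ] IsMatching K L × size M′ ≡ 2 * length L × All (λ w → mate M′ w ≢ w) (endpoints L)
        rec = go s M′ smaller
        L = proj₁ rec
        isM = proj₁ (proj₂ rec)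
        size-L = proj₁ (proj₂ (proj₂ rec))
        inside = proj₂ (proj₂ (proj₂ rec))
        differs-v : ∀ {w} → mate M′ w ≢ w → v ≢ w
        differs-v r refl = r (dropMate-v M v)
        differs-mv : ∀ {w} → mate M′ w ≢ w → mate M v ≢ w
        differs-mv r refl = r (dropMate-mv M v)
        coveredM : ∀ {w} → mate M′ w ≢ w → mate M w ≢ w
        coveredM {w} r q = r (≡.trans (Drop.dropMate-else M v (differs-v r ∘ ≡.sym) (differs-mv r ∘ ≡.sym)) q)

    -- Edges are joined one at a time. The recursion carries along that vertices off the list stay
    -- fixed, as `join` requires of both ends of the next edge.
    fromList : ∀ L → IsMatching K L → ∃[ M ] size {K = K} M ≡ 2 * length L
    fromList L isM = let M , eq , _ = go L isM in M , eq
      where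
      go : ∀ L → IsMatching K L →
           ∃[ M ] size {K = K} M ≡ 2 * length L × (∀ w → All (w ≢_) (endpoints L) → mate M w ≡ w)
      go [] _ = empty K , size-empty K , λ _ _ → refl
      go ((a , b) ∷ L) (ab ∷ edges , (a≢b ∷ a∉) ∷ b∉ ∷ uniq)
        with M , eq , fixed ← go L (edges , uniq)
        = join M a b ab (fixed a a∉) (fixed b b∉)
        , ≡.trans (size-join M a b ab (fixed a a∉) (fixed b b∉)) (≡.trans (cong (_+ 2) eq) (double-suc (length L)))
        , λ { w (w≢a ∷ w≢b ∷ w∉) → ≡.trans (joinMate-else M a b ab (fixed a a∉) (fixed b b∉) w≢a w≢b) (fixed w w∉) }

  -- Gallai's lemma

  module Gallai (K : Graph n) (κ : ℕ)
                (maximum : (M : Matching K) → size M ≤ κ)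
                (missed : ∀ v → ∃[ M ] (size {K = K} M ≡ κ × mate M v ≡ v)) where

    MissBoth : Fin n → Fin n → Set
    MissBoth u v = ∃[ M ] (size {K = K} M ≡ κ × mate M u ≡ u × mate M v ≡ v)

    MissBoth-sym : ∀ {u v} → MissBoth u v → MissBoth v u
    MissBoth-sym (M , s , p , q) = M , s , q , p

    -- Joining such an edge would produce a matching larger than the maximum.
    no-free-edge : (M : Matching K) → size M ≡ κ → ∀ {u v} → adj K u v ≡ true →
                   mate M u ≡ u → mate M v ≡ v → ⊥
    no-free-edge M s {u} {v} uv p q = <-irrefl s (≤-trans
      (≤-trans (m<m+n (size M) {2} (s≤s z≤n)) (≤-reflexive (≡.sym (Join.size-join M u v uv p q))))
      (maximum (Join.join M u v uv p q)))

    adj⇒¬MissBoth : ∀ {u v} → adj K u v ≡ true → ¬ MissBoth u v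
    adj⇒¬MissBoth uv (M , s , p , q) = no-free-edge M s uv p q

    -- If M misses u and v, a maximum matching N missing t covers both, so it misses some x ≢ t covered by M.
    -- Swapping the edge of M at x into N enlarges M ∩ N and still misses t, which cannot go on forever.
    module Exchange {u v t : Fin n} (u≢v : u ≢ v) (¬ut : ¬ MissBoth u t) (¬tv : ¬ MissBoth t v)
                    (M : Matching K) (sM : size M ≡ κ) (Mu : mate M u ≡ u) (Mv : mate M v ≡ v) where

      -- Summed over `w`, this is twice the number of edges shared by `M` and `N`: the measure that
      -- the exchange increases.
      common : Matching K → Fin n → ℕ
      common N w = covered M w * δ (mate N w) (mate M w)

      common≤1 : ∀ N w → common N w ≤ 1
      common≤1 N w = *-mono-≤ (𝟙≤1 (not (does (mate M w ≟ w)))) (𝟙≤1 (does (mate N w ≟ mate M w)))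

      common-≢ : ∀ N {w} → mate N w ≢ mate M w → common N w ≡ 0
      common-≢ N {w} p rewrite δ-≢ p = *-zeroʳ (covered M w)

      -- Without such an `x`, every vertex other than `t` that `N` misses is missed by `M`, which in
      -- addition misses `u` and `v`, both covered by `N`. Then `M` would miss more vertices than
      -- `N`, although the sizes agree.
      candidate : (N : Matching K) → size N ≡ κ → mate N t ≡ t →
                  ∃[ x ] (mate N x ≡ x × mate M x ≢ x × x ≢ t)
      candidate N sN Nt
        with any? (λ x → (mate N x ≟ x) ×-dec (¬? (mate M x ≟ x) ×-dec ¬? (x ≟ t)))
      ... | yes x = x
      ... | no none = ⊥-elim (<-irrefl refl (begin-strict
        sum (free M) + 1                                    <⟨ +-monoʳ-< (sum (free M)) (s≤s (s≤s z≤n)) ⟩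
        sum (free M) + 2                                    ≡⟨ cong (_+ 2) same-free ⟩
        sum (free N) + 2                                    ≡⟨ sum-pair (free N) u v ⟨
        sum (λ w → free N w + (δ u w + δ v w))              ≤⟨ sum-mono pointwise ⟩
        sum (λ w → free M w + δ t w)                        ≡⟨ ∑-distrib-+ (free M) (δ t) ⟩
        sum (free M) + sum (δ t)                            ≡⟨ cong (sum (free M) +_) (sum-δ t) ⟩
        sum (free M) + 1                                    ∎))
        where
        open ≤-Reasoning
        sum-free : (L : Matching K) → sum (free L) + size L ≡ sum {n} (λ _ → 1)
        sum-free L = ≡.trans (≡.sym (∑-distrib-+ (free L) (covered L))) (sum-cong-≗ (free+covered L))
        same-free : sum (free M) ≡ sum (free N)
        same-free = +-cancelʳ-≡ κ _ _ (≡.trans (cong (sum (free M) +_) (≡.sym sM))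
          (≡.trans (sum-free M) (≡.trans (≡.sym (sum-free N)) (cong (sum (free N) +_) sN))))
        Nu : mate N u ≢ u
        Nu p = ¬ut (N , sN , p , Nt)
        Nv : mate N v ≢ v
        Nv p = ¬tv (N , sN , Nt , p)
        pointwise : ∀ w → free N w + (δ u w + δ v w) ≤ free M w + δ t w
        pointwise w with u ≟ w | v ≟ w | t ≟ w
        ... | yes refl | yes refl | _ = contradiction refl u≢v
        ... | yes refl | no _ | _ rewrite δ-≢ Nu | Mu | δ-refl u = s≤s z≤n
        ... | no _ | yes refl | _ rewrite δ-≢ Nv | Mv | δ-refl v = s≤s z≤n
        ... | no _ | no _ | yes refl rewrite +-identityʳ (free N w) =
          ≤-trans (𝟙≤1 (does (mate N w ≟ w))) (m≤n+m 1 (free M w))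
        ... | no _ | no _ | no t≢w rewrite +-identityʳ (free N w) | +-identityʳ (free M w)
            with mate N w ≟ w
        ... | no _ = z≤n
        ... | yes Nw with mate M w ≟ w
        ... | yes _ = s≤s z≤n
        ... | no Mw = contradiction (w , Nw , Mw , t≢w ∘ ≡.sym) none

      step : (N : Matching K) → size N ≡ κ → mate N t ≡ t →
             ∃[ N′ ] (size {K = K} N′ ≡ κ × mate N′ t ≡ t × sum (common N) < sum (common N′))
      step N sN Nt with x , Nx , Mx , x≢t ← candidate N sN Nt = N′ , sN′ , N′t , increase
        where
        y = mate M x
        xy : adj K x y ≡ true
        xy = edge M x Mx
        Ny : mate N y ≢ y
        Ny p = no-free-edge N sN xy Nx p
        Ny≢x : mate N y ≢ x
        Ny≢x p = Mx (mate-injective N (≡.trans p (≡.sym Nx)))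
        module D = Drop N y
        fx : mate D.drop x ≡ x
        fx = ≡.trans (D.dropMate-else (Mx ∘ ≡.sym) (Ny≢x ∘ ≡.sym)) Nx
        module J = Join D.drop x y xy fx D.dropMate-v
        N′ = J.join
        sN′ : size N′ ≡ κ
        sN′ = ≡.trans J.size-join (≡.trans (≡.sym (D.size-drop Ny)) sN)
        unchanged : ∀ {w} → w ≢ x → w ≢ y → w ≢ mate N y → mate N′ w ≡ mate N w
        unchanged p q r = ≡.trans (J.joinMate-else p q) (D.dropMate-else q r)
        t≢y : t ≢ y
        t≢y p = Ny (subst (λ z → mate N z ≡ z) p Nt)
        t≢Ny : t ≢ mate N y
        t≢Ny p = mate-covered N Ny (subst (λ z → mate N z ≡ z) p Nt)
        N′t : mate N′ t ≡ t
        N′t = ≡.trans (unchanged (x≢t ∘ ≡.sym) t≢y t≢Ny) Nt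
        -- Counting the gain at `x` suffices. The dropped edge of `N` is not in `M`, where `y` is
        -- paired with `x`, so its two ends contributed nothing before.
        pointwise : ∀ w → common N w + δ x w ≤ common N′ w
        pointwise w with x ≟ w
        ... | yes refl rewrite common-≢ N {x} (λ p → Mx (≡.trans (≡.sym p) Nx))
                             | covered-yes M Mx | J.joinMate-a | δ-refl y = s≤s z≤n
        ... | no x≢w rewrite +-identityʳ (common N w) = kept (D.dropMate-cases w)
          where
          kept : (w ≡ y ⊎ w ≡ mate N y) ⊎ (w ≢ y × w ≢ mate N y) → common N w ≤ common N′ w
          kept (inj₁ (inj₁ refl)) = ≤-trans
            (≤-reflexive (common-≢ N {y} (λ p → Ny≢x (≡.trans p (involutive M x))))) z≤n
          kept (inj₁ (inj₂ refl)) = ≤-trans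
            (≤-reflexive (common-≢ N {mate N y} (λ p → Ny≢x (mate-injective M (≡.trans (≡.sym p) (involutive N y)))))) z≤n
          kept (inj₂ (w≢y , w≢Ny)) = ≤-reflexive
            (cong (λ z → covered M w * δ z (mate M w)) (≡.sym (unchanged (x≢w ∘ ≡.sym) w≢y w≢Ny)))
        increase : sum (common N) < sum (common N′)
        increase = begin-strict
          sum (common N)                      <⟨ m<m+n (sum (common N)) (s≤s z≤n) ⟩
          sum (common N) + 1                  ≡⟨ cong (sum (common N) +_) (sum-δ x) ⟨
          sum (common N) + sum (δ x)          ≡⟨ ∑-distrib-+ (common N) (δ x) ⟨
          sum (λ w → common N w + δ x w)      ≤⟨ sum-mono pointwise ⟩
          sum (common N′)                     ∎
          where open ≤-Reasoning

      impossible : ⊥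
      impossible with N , sN , Nt ← missed t = go (sum {n} (λ _ → 1)) N sN Nt (m≤n+m _ _)
        where
        -- The sum of `common` grows strictly but is at most the number of vertices; `fuel` bounds
        -- the room that is left.
        go : ∀ fuel (N : Matching K) → size N ≡ κ → mate N t ≡ t → sum {n} (λ _ → 1) ≤ sum (common N) + fuel → ⊥
        go fuel N sN Nt bound with step N sN Nt
        go zero N sN Nt bound | N′ , _ , _ , inc = <-irrefl refl
          (≤-trans inc (≤-trans (sum-mono (common≤1 N′)) (≤-trans bound (≤-reflexive (+-identityʳ _)))))
        go (suc fuel) N sN Nt bound | N′ , sN′ , N′t , inc = go fuel N′ sN′ N′t
          (≤-trans bound (≤-trans (≤-reflexive (+-suc _ fuel)) (+-monoˡ-≤ fuel inc)))

    -- Distinctness of `u` and `v` is essential: by `missed`, `MissBoth u u` always holds. The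
    -- equivalence relation is thus "equal or never missed together".
    ¬MissBoth-trans : ∀ {u t v} → u ≢ v → ¬ MissBoth u t → ¬ MissBoth t v → ¬ MissBoth u v
    ¬MissBoth-trans u≢v ¬ut ¬tv (M , sM , Mu , Mv) = Exchange.impossible u≢v ¬ut ¬tv M sM Mu Mv

    module Classes (missBoth? : ∀ u v → Dec (MissBoth u v)) where

      -- Indicates distinct members of one class, so that `others v` below is the size of the class
      -- of `v` minus one.
      E : Fin n → Fin n → ℕ
      E u v = 𝟙 (not (does (u ≟ v)) ∧ not (does (missBoth? u v)))

      E≤1 : ∀ u v → E u v ≤ 1
      E≤1 u v = 𝟙≤1 (not (does (u ≟ v)) ∧ not (does (missBoth? u v)))

      E-yes : ∀ {u v} → u ≢ v → ¬ MissBoth u v → E u v ≡ 1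
      E-yes {u} {v} p q with u ≟ v | missBoth? u v
      ... | yes r | _     = contradiction r p
      ... | no _  | yes r = contradiction r q
      ... | no _  | no _  = refl

      E-inv : ∀ {u v} → 1 ≤ E u v → u ≢ v × ¬ MissBoth u v
      E-inv {u} {v} p with u ≟ v | missBoth? u v
      ... | no q | no r = q , r

      E-sym : ∀ {u v} → 1 ≤ E u v → E v u ≡ 1
      E-sym p with q , r ← E-inv p = E-yes (q ∘ ≡.sym) (r ∘ MissBoth-sym)

      E-trans : ∀ {u t v} → u ≢ v → 1 ≤ E u t → 1 ≤ E t v → E u v ≡ 1
      E-trans u≢v p q = E-yes u≢v (¬MissBoth-trans u≢v (proj₂ (E-inv p)) (proj₂ (E-inv q)))

      adj⇒E : ∀ {u v} → adj K u v ≡ true → E u v ≡ 1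
      adj⇒E uv = E-yes (adj⇒≢ K uv) (adj⇒¬MissBoth uv)

      others : Fin n → ℕ
      others v = sum (E v)

      -- Adding `δ` restores the member left out, and the full class of `u` is contained in the full
      -- class of `v` by transitivity.
      others-mono : ∀ {u v} → 1 ≤ E u v → others u ≤ others v
      others-mono {u} {v} p = +-cancelʳ-≤ 1 _ _ (begin
        others u + 1                   ≡⟨ cong (others u +_) (sum-δ u) ⟨
        others u + sum (δ u)           ≡⟨ ∑-distrib-+ (E u) (δ u) ⟨
        sum (λ w → E u w + δ u w)      ≤⟨ sum-mono pointwise ⟩
        sum (λ w → E v w + δ v w)      ≡⟨ ∑-distrib-+ (E v) (δ v) ⟩
        others v + sum (δ v)           ≡⟨ cong (others v +_) (sum-δ v) ⟩
        others v + 1                   ∎)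
        where
        open ≤-Reasoning
        pointwise : ∀ w → E u w + δ u w ≤ E v w + δ v w
        pointwise w with u ≟ w
        ... | yes refl rewrite E-sym p = s≤s z≤n
        ... | no u≢w rewrite +-identityʳ (𝟙 (not (does (missBoth? u w)))) with missBoth? u w
        ... | yes _ = z≤n
        ... | no ¬uw with v ≟ w
        ... | yes refl = s≤s z≤n
        ... | no v≢w with missBoth? v w
        ... | no _ = s≤s z≤n
        ... | yes vw = contradiction vw
          (¬MissBoth-trans v≢w (proj₂ (E-inv p) ∘ MissBoth-sym) ¬uw)

      others-cong : ∀ {u v} → 1 ≤ E u v → others u ≡ others v
      others-cong p = ≤-antisym (others-mono p) (others-mono (≤-reflexive (≡.sym (E-sym p))))

      deg≤others : ∀ v → deg K v ≤ others v
      deg≤others v rewrite deg≡sum K v = sum-mono pointwise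
        where
        pointwise : ∀ w → 𝟙 (adj K v w) ≤ E v w
        pointwise w with adj K v w in eq
        ... | true  = ≤-reflexive (≡.sym (adj⇒E eq))
        ... | false = z≤n

  -- Weighing classes by their size

  nontrivial large : ℕ → ℕ
  nontrivial zero    = 0
  nontrivial (suc _) = 1
  large (suc (suc (suc (suc (suc _))))) = 1
  large _                               = 0

  -- The argument of these functions is the number of other members of a class.  The vertex of a class that a
  -- maximum matching misses has its demand paid by its classmates, each of which can spare 6 ∸ demand.
  demand pay : ℕ → ℕ
  demand e = 4 * nontrivial e + large e
  pay (suc (suc (suc (suc (suc _))))) = 1
  pay _                               = 2

  -- A class of two members fails: a single classmate pays 2 towards a demand of 4. Equality holds
  -- at `e = 2` and `e = 5`, and from 5 classmates on a payment of 1 each is enough.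
  demand≤e*pay : ∀ e → e ≢ 1 → demand e ≤ pay e * e
  demand≤e*pay 0 _ = z≤n
  demand≤e*pay 1 p = contradiction refl p
  demand≤e*pay 2 _ = ≤-refl
  demand≤e*pay 3 _ = m≤m+n 4 2
  demand≤e*pay 4 _ = m≤m+n 4 4
  demand≤e*pay (suc (suc (suc (suc (suc e))))) _ = m≤m+n 5 (e + 0)

  pay+demand≤6 : ∀ e → pay e + demand e ≤ 6
  pay+demand≤6 0 = m≤m+n 2 4
  pay+demand≤6 1 = ≤-refl
  pay+demand≤6 2 = ≤-refl
  pay+demand≤6 3 = ≤-refl
  pay+demand≤6 4 = ≤-refl
  pay+demand≤6 (suc (suc (suc (suc (suc e))))) = ≤-refl

  module _ (K : Graph n) (κ : ℕ)
           (maximum : (M : Matching K) → size M ≤ κ)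
           (missed : ∀ v → ∃[ M ] (size {K = K} M ≡ κ × mate M v ≡ v))
           (missBoth? : ∀ u v → Dec (Gallai.MissBoth K κ maximum missed u v))
           (M : Matching K) (sM : size M ≡ κ) where

    open Gallai K κ maximum missed
    open Classes missBoth?

    free-classmates : ∀ {u v} → 1 ≤ E u v → mate M u ≡ u → mate M v ≢ v
    free-classmates p Mu Mv = proj₂ (E-inv p) (M , sM , Mu , Mv)

    -- A classmate `v` of a missed `f` is covered, and its partner, being adjacent to `v`, is a
    -- further classmate of `f`.
    free⇒others≢1 : ∀ {f} → mate M f ≡ f → others f ≢ 1
    free⇒others≢1 {f} Mf eq with v , fv ← sum-positive (E f) (≤-reflexive (≡.sym eq)) =
      contradiction (≤-trans (two-terms≤sum (E f) v w (Mv ∘ ≡.sym)) (≤-reflexive eq))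
        (<⇒≱ (+-mono-≤ fv (≤-reflexive (≡.sym fw))))
      where
      Mv : mate M v ≢ v
      Mv = free-classmates fv Mf
      w = mate M v
      f≢w : f ≢ w
      f≢w refl = Mv (mate-injective M Mf)
      fw : E f w ≡ 1
      fw = E-trans f≢w fv (≤-reflexive (≡.sym (adj⇒E (edge M v Mv))))

    -- All classmates of a missed vertex are covered, and a covered vertex has at most one missed
    -- classmate. After the payments the missed vertices carry nothing and each covered vertex
    -- carries at most 6.
    sum-demand-others : sum (λ v → demand (others v)) ≤ 6 * κ
    sum-demand-others = begin
      sum (λ v → demand (others v))
        ≡⟨ sum-cong-≗ split ⟩
      sum (λ v → free M v * demand (others v) + covered M v * demand (others v))
        ≡⟨ ∑-distrib-+ (λ v → free M v * demand (others v)) (λ v → covered M v * demand (others v)) ⟩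
      sum (λ v → free M v * demand (others v)) + sum (λ v → covered M v * demand (others v))
        ≤⟨ +-monoˡ-≤ _ transfer ⟩
      sum (λ v → pay (others v) * covered M v) + sum (λ v → covered M v * demand (others v))
        ≡⟨ ∑-distrib-+ (λ v → pay (others v) * covered M v) (λ v → covered M v * demand (others v)) ⟨
      sum (λ v → pay (others v) * covered M v + covered M v * demand (others v))
        ≤⟨ sum-mono total ⟩
      sum (λ v → 6 * covered M v)
        ≡⟨ sum-*ˡ (covered M) 6 ⟩
      6 * size M
        ≡⟨ cong (6 *_) sM ⟩
      6 * κ ∎
      where
      open ≤-Reasoning
      split : ∀ v → demand (others v) ≡ free M v * demand (others v) + covered M v * demand (others v)
      split v = ≡.trans (≡.sym (*-identityˡ _)) (≡.trans
        (cong (_* demand (others v)) (≡.sym (free+covered M v)))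
        (*-distribʳ-+ (demand (others v)) (free M v) (covered M v)))
      total : ∀ v → pay (others v) * covered M v + covered M v * demand (others v) ≤ 6 * covered M v
      total v = ≤-trans (≤-reflexive (factor (pay (others v)) (covered M v) (demand (others v))))
        (*-monoˡ-≤ (covered M v) (pay+demand≤6 (others v)))
        where
        factor : ∀ p c d → p * c + c * d ≡ (p + d) * c
        factor = solve-∀
      -- `T f v` is what `v` pays for the missed vertex `f`.
      T : Fin n → Fin n → ℕ
      T f v = free M f * (pay (others f) * E f v)
      supply : ∀ f → free M f * demand (others f) ≤ sum (T f)
      supply f with mate M f ≟ f
      ... | no _ = z≤n
      ... | yes Mf = begin
        demand (others f) + 0                        ≡⟨ +-identityʳ _ ⟩
        demand (others f)                            ≤⟨ demand≤e*pay (others f) (free⇒others≢1 Mf) ⟩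
        pay (others f) * others f                    ≡⟨ sum-*ˡ (E f) (pay (others f)) ⟨
        sum (λ v → pay (others f) * E f v)
          ≡⟨ sum-cong-≗ (λ v → ≡.sym (+-identityʳ (pay (others f) * E f v))) ⟩
        sum (λ v → 1 * (pay (others f) * E f v))     ∎
      -- Members of one class have equally many classmates, so the rate of payment can be read at
      -- the payer instead of at `f`.
      move : ∀ f v → T f v ≤ pay (others v) * (free M f * E f v)
      move f v with E f v in eq
      ... | zero rewrite *-zeroʳ (pay (others f)) | *-zeroʳ (free M f) = z≤n
      ... | suc e rewrite others-cong {f} {v} (subst (1 ≤_) (≡.sym eq) (s≤s z≤n)) =
        ≤-reflexive (assoc (free M f) (pay (others v)) e)
        where
        assoc : ∀ a b e → a * (b * suc e) ≡ b * (a * suc e)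
        assoc = solve-∀
      one-payee : ∀ v → sum (λ f → free M f * E f v) ≤ covered M v
      one-payee v with mate M v ≟ v
      ... | yes Mv = ≤-reflexive (sum-zero (λ f → free M f * E f v) none)
        where
        none : ∀ f → free M f * E f v ≡ 0
        none f with mate M f ≟ f
        ... | no _ = refl
        ... | yes Mf = n≤0⇒n≡0 (≮⇒≥ λ p → free-classmates (≤-trans p (≤-reflexive (+-identityʳ (E f v)))) Mf Mv)
      ... | no Mv = sum-at-most-one (λ f → free M f * E f v)
          (λ f → *-mono-≤ (𝟙≤1 (does (mate M f ≟ f))) (E≤1 f v)) unique
        where
        both : ∀ f → 1 ≤ free M f * E f v → mate M f ≡ f × 1 ≤ E f v
        both f p with mate M f ≟ f
        ... | yes Mf = Mf , ≤-trans p (≤-reflexive (+-identityʳ (E f v)))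
        unique : ∀ f g → 1 ≤ free M f * E f v → 1 ≤ free M g * E g v → f ≡ g
        unique f g p q with both f p | both g q | f ≟ g
        ... | _ | _ | yes f≡g = f≡g
        ... | Mf , fv | Mg , gv | no f≢g = contradiction Mg
          (free-classmates (≤-reflexive (≡.sym (E-trans f≢g fv (≤-reflexive (≡.sym (E-sym gv)))))) Mf)
      transfer : sum (λ v → free M v * demand (others v)) ≤ sum (λ v → pay (others v) * covered M v)
      transfer = begin
        sum (λ f → free M f * demand (others f))
          ≤⟨ sum-mono supply ⟩
        sum (λ f → sum (λ v → T f v))
          ≡⟨ ∑-comm T ⟩
        sum (λ v → sum (λ f → T f v))
          ≤⟨ sum-mono (λ v → sum-mono (λ f → move f v)) ⟩
        sum (λ v → sum (λ f → pay (others v) * (free M f * E f v)))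
          ≡⟨ sum-cong-≗ (λ v → sum-*ˡ (λ f → free M f * E f v) (pay (others v))) ⟩
        sum (λ v → pay (others v) * sum (λ f → free M f * E f v))
          ≤⟨ sum-mono (λ v → *-monoʳ-≤ (pay (others v)) (one-payee v)) ⟩
        sum (λ v → pay (others v) * covered M v) ∎

  -- A Tutte–Berge decomposition

  -- Double-negation shift over a finite index set; it lets excluded middle be assumed at all
  -- vertices, or at all pairs of vertices, at once.
  ¬¬-∀Fin : {P : Fin n → Set} → (∀ i → ¬ ¬ P i) → ¬ ¬ (∀ i → P i)
  ¬¬-∀Fin {zero}  p k = k λ ()
  ¬¬-∀Fin {suc n} p k = p zero λ p₀ → ¬¬-∀Fin (p ∘ suc) λ pₛ → k λ { zero → p₀ ; (suc i) → pₛ i }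

  infixl 6 _∖_

  -- Vertices of `A` remain as isolated vertices, so the vertex set is still `Fin n` and every
  -- matching of the smaller graph misses them.
  _∖_ : Graph n → (Fin n → Bool) → Graph n
  (K ∖ A) .adj u v      = adj K u v ∧ (not (A u) ∧ not (A v))
  (K ∖ A) .sym u v rewrite sym K u v with adj K v u | A u | A v
  ... | false | _     | _     = refl
  ... | true  | false | false = refl
  ... | true  | false | true  = refl
  ... | true  | true  | false = refl
  ... | true  | true  | true  = refl
  (K ∖ A) .irrefl u rewrite irrefl K u = refl

  ∖-adj⁻ : (K : Graph n) (A : Fin n → Bool) {u v : Fin n} → adj (K ∖ A) u v ≡ true →
           adj K u v ≡ true × A u ≡ false × A v ≡ false
  ∖-adj⁻ K A {u} {v} p with adj K u v | A u | A v
  ... | true | false | false = refl , refl , refl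

  ∖-adj⁺ : (K : Graph n) (A : Fin n → Bool) {u v : Fin n} →
           adj K u v ≡ true → A u ≡ false → A v ≡ false → adj (K ∖ A) u v ≡ true
  ∖-adj⁺ K A p q r rewrite p | q | r = refl

  insert : Fin n → (Fin n → Bool) → Fin n → Bool
  insert v A w = A w ∨ does (v ≟ w)

  insert-self : (v : Fin n) (A : Fin n → Bool) → insert v A v ≡ true
  insert-self v A with A v | v ≟ v
  ... | true  | _     = refl
  ... | false | yes _ = refl
  ... | false | no ¬p = contradiction refl ¬p

  insert-false : (v : Fin n) (A : Fin n → Bool) {w : Fin n} → insert v A w ≡ false → A w ≡ false
  insert-false v A {w} p with A w
  ... | false = refl

  insert-other : (v : Fin n) (A : Fin n → Bool) {w : Fin n} → v ≢ w → A w ≡ false → insert v A w ≡ false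
  insert-other v A {w} v≢w p rewrite p with v ≟ w
  ... | yes q = contradiction q v≢w
  ... | no _  = refl

  ∣_∣ : (Fin n → Bool) → ℕ
  ∣ A ∣ = sum (λ v → 𝟙 (A v))

  ∣insert∣ : (v : Fin n) (A : Fin n → Bool) → A v ≡ false → ∣ insert v A ∣ ≡ suc ∣ A ∣
  ∣insert∣ v A Av = begin
    ∣ insert v A ∣                        ≡⟨ sum-cong-≗ pointwise ⟩
    sum (λ w → 𝟙 (A w) + δ v w)          ≡⟨ ∑-distrib-+ (λ w → 𝟙 (A w)) (δ v) ⟩
    ∣ A ∣ + sum (δ v)                     ≡⟨ cong (∣ A ∣ +_) (sum-δ v) ⟩
    ∣ A ∣ + 1                             ≡⟨ +-comm ∣ A ∣ 1 ⟩
    suc ∣ A ∣                             ∎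
    where
    open ≡.≡-Reasoning
    pointwise : ∀ w → 𝟙 (insert v A w) ≡ 𝟙 (A w) + δ v w
    pointwise w with v ≟ w
    ... | yes refl rewrite Av = refl
    ... | no _ with A w
    ... | true  = refl
    ... | false = refl

  size-even : {K : Graph n} (M : Matching K) → ∃[ l ] size M ≡ 2 * l
  size-even M = let L , _ , eq = toList M in length L , eq

  record Barrier (H : Graph n) (μ : ℕ) : Set where
    field
      A       : Fin n → Bool
      k       : ℕ
      count   : ∣ A ∣ + k ≡ μ
      maximum : (M : Matching (H ∖ A)) → size M ≤ 2 * k
      witness : ∃[ M ] size {K = H ∖ A} M ≡ 2 * k
      missed  : ∀ v → ∃[ M ] (size {K = H ∖ A} M ≡ 2 * k × mate M v ≡ v)

  module _ (H : Graph n) where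

    -- If some vertex is covered by all maximum matchings, moving it into `A` lowers the matching
    -- number by exactly one and keeps `∣ A ∣ + k`. The recursion on `k` stops when no such vertex
    -- is left.
    extend-barrier : ∀ k (A : Fin n → Bool) → ((M : Matching (H ∖ A)) → size M ≤ 2 * k) →
                     (M : Matching (H ∖ A)) → size M ≡ 2 * k → ¬ ¬ Barrier H (∣ A ∣ + k)
    extend-barrier k A maximum M sM continue =
      ¬¬-∀Fin (λ v → ¬¬-excluded-middle) λ missed? → decide (all? missed?) missed?
      where
      Missed : Fin n → Set
      Missed v = ∃[ N ] (size {K = H ∖ A} N ≡ 2 * k × mate N v ≡ v)
      essential : ∀ k (M : Matching (H ∖ A)) → size M ≡ 2 * k → ((M : Matching (H ∖ A)) → size M ≤ 2 * k) →
                  ∀ v → ¬ (∃[ N ] (size {K = H ∖ A} N ≡ 2 * k × mate N v ≡ v)) → ¬ ¬ Barrier H (∣ A ∣ + k)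
      -- For `k = 0` the empty matching is already maximum, and it misses `v`.
      essential zero M sM _ v ¬missed _ = ¬missed (empty (H ∖ A) , size-empty (H ∖ A) , refl)
      essential (suc k) M sM maximum v ¬missed continue =
        extend-barrier k A′ maximum′ M′ sM′ λ b → continue (subst (Barrier H) same b)
        where
        A′ = insert v A
        Mv : mate M v ≢ v
        Mv p = ¬missed (M , sM , p)
        Av : A v ≡ false
        Av = proj₁ (proj₂ (∖-adj⁻ H A (edge M v Mv)))
        same : ∣ A′ ∣ + k ≡ ∣ A ∣ + suc k
        same = ≡.trans (cong (_+ k) (∣insert∣ v A Av)) (≡.sym (+-suc ∣ A ∣ k))
        module D = Drop M v
        M′ : Matching (H ∖ A′)
        M′ .mate = D.dropMate
        M′ .involutive = involutive D.drop
        M′ .edge w p with adjH , Aw , Am ← ∖-adj⁻ H A (edge D.drop w p) = ∖-adj⁺ H A′ adjH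
          (insert-other v A (λ { refl → p D.dropMate-v }) Aw)
          (insert-other v A (λ q → p (mate-injective D.drop (subst (λ z → D.dropMate z ≡ z) q D.dropMate-v))) Am)
        sM′ : size M′ ≡ 2 * k
        sM′ = +-cancelʳ-≡ 2 _ _ (≡.trans (≡.sym (D.size-drop Mv)) (≡.trans sM (arith k)))
          where
          arith : ∀ k → 2 * suc k ≡ 2 * k + 2
          arith = solve-∀
        -- A matching that avoids `v` is also one of `H ∖ A` missing `v`, hence not maximum there;
        -- since sizes are even, it falls short by at least 2.
        maximum′ : (N : Matching (H ∖ A′)) → size N ≤ 2 * k
        maximum′ N with l , eq ← size-even N = ≤-trans (≤-reflexive eq) (*-monoʳ-≤ 2 (s≤s⁻¹ (≤∧≢⇒< l≤ l≢)))
          where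
          relaxed : Matching (H ∖ A)
          relaxed .mate = mate N
          relaxed .involutive = involutive N
          relaxed .edge w p with adjH , Aw , Am ← ∖-adj⁻ H A′ (edge N w p) =
            ∖-adj⁺ H A adjH (insert-false v A Aw) (insert-false v A Am)
          Nv : mate N v ≡ v
          Nv with mate N v ≟ v
          ... | yes p = p
          ... | no p with () ← ≡.trans (≡.sym (insert-self v A)) (proj₁ (proj₂ (∖-adj⁻ H A′ (edge N v p))))
          l≤ : l ≤ suc k
          l≤ = *-cancelˡ-≤ 2 (≤-trans (≤-reflexive (≡.sym eq)) (maximum relaxed))
          l≢ : l ≢ suc k
          l≢ refl = ¬missed (relaxed , eq , Nv)
      decide : Dec (∀ v → Missed v) → (∀ v → Dec (Missed v)) → ⊥
      decide (yes missed) _ = continue record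
        { A = A ; k = k ; count = refl ; maximum = maximum ; witness = M , sM ; missed = missed }
      decide (no ¬all) missed? with v , ¬missed ← ¬∀⟶∃¬ n Missed missed? ¬all =
        essential k M sM maximum v ¬missed continue

  -- Degrees outside the barrier

  -- Writing the larger number as the smaller plus `c` exhibits `c * c` as the slack, without a
  -- truncated subtraction in the identity.
  am-gm : ∀ a b → 2 * (a * b) ≤ a * a + b * b
  am-gm a b with ≤-total a b
  ... | inj₁ a≤b = subst (λ b → 2 * (a * b) ≤ a * a + b * b) (m+[n∸m]≡n a≤b) (ordered a (b ∸ a))
    where
    square : ∀ a c → 2 * (a * (a + c)) + c * c ≡ a * a + (a + c) * (a + c)
    square = solve-∀
    ordered : ∀ a c → 2 * (a * (a + c)) ≤ a * a + (a + c) * (a + c)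
    ordered a c = ≤-trans (m≤m+n _ (c * c)) (≤-reflexive (square a c))
  ... | inj₂ b≤a = subst (λ a → 2 * (a * b) ≤ a * a + b * b) (m+[n∸m]≡n b≤a) (ordered b (a ∸ b))
    where
    square : ∀ b c → 2 * ((b + c) * b) + c * c ≡ (b + c) * (b + c) + b * b
    square = solve-∀
    ordered : ∀ b c → 2 * ((b + c) * b) ≤ (b + c) * (b + c) + b * b
    ordered b c = ≤-trans (m≤m+n _ (c * c)) (≤-reflexive (square b c))

  -- By the symmetry of `q`, the double sum of `q u v * d u` equals that of `q u v * d v`; adding
  -- the two forms gives the sum that `bound` controls edge by edge.
  sum-edge-weights : (q : Fin n → Fin n → ℕ) (d : Fin n → ℕ) (B : ℕ) → (∀ u v → q u v ≡ q v u) →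
    (∀ u v → q u v * (d u + d v) ≤ q u v * B) →
    2 * sum (λ u → sum (q u) * d u) ≤ B * sum (λ u → sum (q u))
  sum-edge-weights {n} q d B q-sym bound = begin
    2 * sum (λ u → sum (q u) * d u)
      ≡⟨ cong (sum (λ u → sum (q u) * d u) +_) (+-identityʳ _) ⟩
    sum (λ u → sum (q u) * d u) + sum (λ u → sum (q u) * d u)
      ≡⟨ cong₂ _+_ first second ⟩
    sum (λ u → sum (λ v → q u v * d u)) + sum (λ u → sum (λ v → q u v * d v))
      ≡⟨ ∑-distrib-+ (λ u → sum (λ v → q u v * d u)) (λ u → sum (λ v → q u v * d v)) ⟨
    sum (λ u → sum (λ v → q u v * d u) + sum (λ v → q u v * d v))
      ≡⟨ sum-cong-≗ (λ u → ≡.sym (∑-distrib-+ (λ v → q u v * d u) (λ v → q u v * d v))) ⟩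
    sum (λ u → sum (λ v → q u v * d u + q u v * d v))
      ≤⟨ sum-mono (λ u → sum-mono (λ v → ≤-trans
           (≤-reflexive (≡.sym (*-distribˡ-+ (q u v) (d u) (d v))))
           (≤-trans (bound u v) (≤-reflexive (*-comm (q u v) B))))) ⟩
    sum (λ u → sum (λ v → B * q u v))
      ≡⟨ sum-cong-≗ (λ u → sum-*ˡ (q u) B) ⟩
    sum (λ u → B * sum (q u))
      ≡⟨ sum-*ˡ (λ u → sum (q u)) B ⟩
    B * sum (λ u → sum (q u)) ∎
    where
    open ≤-Reasoning
    inner : ∀ u → sum (q u) * d u ≡ sum (λ v → q u v * d u)
    inner u = ≡.trans (*-comm (sum (q u)) (d u)) (≡.trans (≡.sym (sum-*ˡ (q u) (d u)))
      (sum-cong-≗ (λ v → *-comm (d u) (q u v))))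
    first : sum (λ u → sum (q u) * d u) ≡ sum (λ u → sum (λ v → q u v * d u))
    first = sum-cong-≗ inner
    second : sum (λ u → sum (q u) * d u) ≡ sum (λ u → sum (λ v → q u v * d v))
    second = ≡.trans first (≡.trans (sum-cong-≗ (λ u → sum-cong-≗ (λ v → cong (_* d u) (q-sym u v))))
      (∑-comm (λ u v → q v u * d u)))

  module OutsideDegrees (H : Graph n) (B : ℕ)
         (P1 : ∀ u v → adj H u v ≡ true → deg H u + deg H v ≤ B) (A : Fin n → Bool) where

    inside outside D : Fin n → ℕ
    inside v  = 𝟙 (A v)
    outside v = 𝟙 (not (A v))
    D v       = outside v * deg H v

    c : Fin n → Fin n → ℕ
    c u v = 𝟙 (adj H u v) * (inside u * outside v)

    -- `R u` counts the neighbours outside `A` of a vertex of `A`, and `C u` the neighbours in `A`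
    -- of a vertex outside; each vanishes on the other side.
    R C : Fin n → ℕ
    R u = sum (λ v → c u v)
    C u = sum (λ v → c v u)

    d′ : Fin n → ℕ
    d′ v = deg (H ∖ A) v

    C+d′≡D : ∀ u → C u + d′ u ≡ D u
    C+d′≡D u = begin
      C u + d′ u
        ≡⟨ cong (C u +_) (deg≡sum (H ∖ A) u) ⟩
      C u + sum (λ v → 𝟙 (adj (H ∖ A) u v))
        ≡⟨ ∑-distrib-+ (λ v → c v u) (λ v → 𝟙 (adj (H ∖ A) u v)) ⟨
      sum (λ v → c v u + 𝟙 (adj (H ∖ A) u v))
        ≡⟨ sum-cong-≗ pointwise ⟩
      sum (λ v → outside u * 𝟙 (adj H u v))
        ≡⟨ sum-*ˡ (λ v → 𝟙 (adj H u v)) (outside u) ⟩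
      outside u * sum (λ v → 𝟙 (adj H u v))
        ≡⟨ cong (outside u *_) (deg≡sum H u) ⟨
      D u ∎
      where
      open ≡.≡-Reasoning
      pointwise : ∀ v → c v u + 𝟙 (adj (H ∖ A) u v) ≡ outside u * 𝟙 (adj H u v)
      pointwise v rewrite sym H v u with adj H u v | A u | A v
      ... | false | true  | _     = refl
      ... | false | false | _     = refl
      ... | true  | false | false = refl
      ... | true  | false | true  = refl
      ... | true  | true  | false = refl
      ... | true  | true  | true  = refl

    d′≤D : ∀ u → d′ u ≤ D u
    d′≤D u = ≤-trans (m≤n+m (d′ u) (C u)) (≤-reflexive (C+d′≡D u))

    D≤deg : ∀ u → D u ≤ deg H u
    D≤deg u = ≤-trans (*-monoˡ-≤ (deg H u) (𝟙≤1 (not (A u)))) (≤-reflexive (*-identityˡ (deg H u)))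

    R≤deg : ∀ u → R u ≤ deg H u
    R≤deg u rewrite deg≡sum H u = sum-mono pointwise
      where
      pointwise : ∀ v → c u v ≤ 𝟙 (adj H u v)
      pointwise v = ≤-trans (*-monoʳ-≤ (𝟙 (adj H u v)) (*-mono-≤ (𝟙≤1 (A u)) (𝟙≤1 (not (A v)))))
        (≤-reflexive (*-identityʳ _))

    -- For `u` in `A` this is the nonnegativity of the square of 2R - B. Elsewhere `R u` is 0, so
    -- the charge of B² falls on vertices of `A` alone.
    R-am-gm : ∀ u → 4 * (B * R u) ≤ 4 * (R u * R u) + inside u * (B * B)
    R-am-gm u = go (A u) refl
      where
      open ≤-Reasoning
      lhs : ∀ B r → 4 * (B * r) ≡ 2 * (2 * r * B)
      lhs = solve-∀
      rhs : ∀ B r → 2 * r * (2 * r) + B * B ≡ 4 * (r * r) + 1 * (B * B)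
      rhs = solve-∀
      R≡0 : A u ≡ false → R u ≡ 0
      R≡0 eq = sum-zero (λ v → c u v) (λ v → ≡.trans
        (cong (λ b → 𝟙 (adj H u v) * (𝟙 b * outside v)) eq) (*-zeroʳ (𝟙 (adj H u v))))
      go : ∀ b → A u ≡ b → 4 * (B * R u) ≤ 4 * (R u * R u) + 𝟙 b * (B * B)
      go true _ = begin
        4 * (B * R u)                          ≡⟨ lhs B (R u) ⟩
        2 * (2 * R u * B)                      ≤⟨ am-gm (2 * R u) B ⟩
        2 * R u * (2 * R u) + B * B            ≡⟨ rhs B (R u) ⟩
        4 * (R u * R u) + 1 * (B * B)          ∎
      go false eq rewrite R≡0 eq | *-zeroʳ B = z≤n

    -- Indicates the edges of `H` not inside `A`: the summands are the exclusive cases of only `u`,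
    -- only `v`, or neither end in `A`.
    weight : Fin n → Fin n → ℕ
    weight u v = c u v + c v u + 𝟙 (adj (H ∖ A) u v)

    sum-weight : ∀ u → sum (weight u) ≡ R u + D u
    sum-weight u = begin
      sum (weight u)
        ≡⟨ ∑-distrib-+ (λ v → c u v + c v u) (λ v → 𝟙 (adj (H ∖ A) u v)) ⟩
      sum (λ v → c u v + c v u) + sum (λ v → 𝟙 (adj (H ∖ A) u v))
        ≡⟨ cong₂ _+_ (∑-distrib-+ (λ v → c u v) (λ v → c v u)) (≡.sym (deg≡sum (H ∖ A) u)) ⟩
      R u + C u + d′ u
        ≡⟨ +-assoc (R u) (C u) (d′ u) ⟩
      R u + (C u + d′ u)
        ≡⟨ cong (R u +_) (C+d′≡D u) ⟩
      R u + D u ∎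
      where open ≡.≡-Reasoning

    weight-sym : ∀ u v → weight u v ≡ weight v u
    weight-sym u v = cong₂ _+_ (+-comm (c u v) (c v u)) (cong 𝟙 (sym (H ∖ A) u v))

    weight-bound : ∀ u v → weight u v * (deg H u + deg H v) ≤ weight u v * B
    weight-bound u v with adj H u v in eq
    ... | true = *-monoʳ-≤ (1 * (inside u * outside v) + c v u + 𝟙 (not (A u) ∧ not (A v))) (P1 u v eq)
    ... | false rewrite sym H v u | eq = z≤n

    sum-D≡ : sum D ≡ sum R + sum d′
    sum-D≡ = ≡.trans (sum-cong-≗ (≡.sym ∘ C+d′≡D)) (≡.trans (∑-distrib-+ C d′)
      (cong (_+ sum d′) (∑-comm (λ u v → c v u))))

    -- P1 over the edges not inside `A` bounds the sum of R² + D², because both R and D are at most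
    -- the degree in `H`. By `R-am-gm` the term in B and R is at most the R² term, which cancels,
    -- plus B² for each vertex of `A`.
    sum-D² : 4 * sum (λ v → D v * D v) ≤ ∣ A ∣ * (B * B) + 2 * (B * sum d′)
    sum-D² = combine (sum (λ v → D v * D v)) (sum (λ v → R v * R v)) (∣ A ∣ * (B * B)) (B * sum R) (B * sum d′)
      edges amgm
      where
      open ≤-Reasoning
      edges : 2 * (sum (λ v → R v * R v) + sum (λ v → D v * D v)) ≤ 2 * (B * sum R) + B * sum d′
      edges = begin
        2 * (sum (λ v → R v * R v) + sum (λ v → D v * D v))
          ≡⟨ cong (2 *_) (∑-distrib-+ (λ v → R v * R v) (λ v → D v * D v)) ⟨
        2 * sum (λ v → R v * R v + D v * D v)
          ≤⟨ *-monoʳ-≤ 2 (sum-mono pointwise) ⟩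
        2 * sum (λ v → sum (weight v) * deg H v)
          ≤⟨ sum-edge-weights weight (deg H) B weight-sym weight-bound ⟩
        B * sum (λ v → sum (weight v))
          ≡⟨ cong (B *_) (≡.trans (sum-cong-≗ sum-weight) (≡.trans (∑-distrib-+ R D) (cong (sum R +_) sum-D≡))) ⟩
        B * (sum R + (sum R + sum d′))
          ≡⟨ expand B (sum R) (sum d′) ⟩
        2 * (B * sum R) + B * sum d′ ∎
        where
        expand : ∀ B r d → B * (r + (r + d)) ≡ 2 * (B * r) + B * d
        expand = solve-∀
        pointwise : ∀ v → R v * R v + D v * D v ≤ sum (weight v) * deg H v
        pointwise v = begin
          R v * R v + D v * D v              ≤⟨ +-mono-≤ (*-monoʳ-≤ (R v) (R≤deg v)) (*-monoʳ-≤ (D v) (D≤deg v)) ⟩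
          R v * deg H v + D v * deg H v      ≡⟨ *-distribʳ-+ (deg H v) (R v) (D v) ⟨
          (R v + D v) * deg H v              ≡⟨ cong (_* deg H v) (sum-weight v) ⟨
          sum (weight v) * deg H v                ∎
      amgm : 4 * (B * sum R) ≤ 4 * sum (λ v → R v * R v) + ∣ A ∣ * (B * B)
      amgm = begin
        4 * (B * sum R)
          ≡⟨ ≡.trans (sum-*ˡ (λ v → B * R v) 4) (cong (4 *_) (sum-*ˡ R B)) ⟨
        sum (λ v → 4 * (B * R v))
          ≤⟨ sum-mono R-am-gm ⟩
        sum (λ v → 4 * (R v * R v) + inside v * (B * B))
          ≡⟨ ∑-distrib-+ (λ v → 4 * (R v * R v)) (λ v → inside v * (B * B)) ⟩
        sum (λ v → 4 * (R v * R v)) + sum (λ v → inside v * (B * B))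
          ≡⟨ cong₂ _+_ (sum-*ˡ (λ v → R v * R v) 4)
               (≡.trans (sum-cong-≗ (λ v → *-comm (inside v) (B * B)))
                 (≡.trans (sum-*ˡ inside (B * B)) (*-comm (B * B) ∣ A ∣))) ⟩
        4 * sum (λ v → R v * R v) + ∣ A ∣ * (B * B) ∎
      combine : ∀ D² R² a r d → 2 * (R² + D²) ≤ 2 * r + d → 4 * r ≤ 4 * R² + a → 4 * D² ≤ a + 2 * d
      combine D² R² a r d e g = +-cancelˡ-≤ (4 * R²) _ _ (begin
        4 * R² + 4 * D²          ≡⟨ lhs R² D² ⟩
        2 * (2 * (R² + D²))      ≤⟨ *-monoʳ-≤ 2 e ⟩
        2 * (2 * r + d)          ≡⟨ mid r d ⟩
        4 * r + 2 * d            ≤⟨ +-monoˡ-≤ (2 * d) g ⟩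
        4 * R² + a + 2 * d       ≡⟨ +-assoc (4 * R²) a (2 * d) ⟩
        4 * R² + (a + 2 * d)     ∎)
        where
        lhs : ∀ R D → 4 * R + 4 * D ≡ 2 * (2 * (R + D))
        lhs = solve-∀
        mid : ∀ r d → 2 * (2 * r + d) ≡ 4 * r + 2 * d
        mid = solve-∀

  -- The local inequalities

  module Potential (p q B b : ℕ) (B≥50/ε : 50 * q ≤ p * B) (b≥ : 10 * (q * B) ≤ 10 * (q * b) + p * B) where

    -- With ε = p / q, scaled by 4q: s is the indicator of S, d a degree in H ∖ A, x a degree in H, and e the
    -- number of classmates; the last summand of the credit is the error term of order ε.
    cost : ℕ → ℕ → ℕ
    cost d s = 8 * (q * (B * d)) + 4 * (q * (B * B)) * s

    credit : ℕ → ℕ → ℕ → ℕ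
    credit x e s = 16 * (q * (x * x)) + q * (B * B) * large e + 2 * (p * (B * B)) * (s + nontrivial e)

    -- Lets terms linear in B, which come from the bounded degrees in small classes, be absorbed
    -- into the error of order ε.
    qB≤ : 50 * (q * B) ≤ p * (B * B)
    qB≤ = ≤-trans (≤-reflexive (lhs q B)) (≤-trans (*-monoˡ-≤ B B≥50/ε) (≤-reflexive (*-assoc p B B)))
      where
      lhs : ∀ q B → 50 * (q * B) ≡ 50 * q * B
      lhs = solve-∀

    small-cost : ∀ {d} → d ≤ 4 → 8 * (q * (B * d)) ≤ 32 * (q * B)
    small-cost {d} d≤4 = ≤-trans (*-monoʳ-≤ 8 (*-monoʳ-≤ q (*-monoʳ-≤ B d≤4))) (≤-reflexive (rhs q B))
      where
      rhs : ∀ q B → 8 * (q * (B * 4)) ≡ 32 * (q * B)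
      rhs = solve-∀

    module Lone (x : ℕ) where

      open ≤-Reasoning

      small : ∀ e {d} → d ≤ 4 → large e ≡ 0 → nontrivial e ≡ 1 → cost d 0 ≤ credit x e 0
      small e {d} d≤4 l≡0 t≡1 rewrite l≡0 | t≡1 = begin
        8 * (q * (B * d)) + 4 * (q * (B * B)) * 0   ≡⟨ cong (8 * (q * (B * d)) +_) (*-zeroʳ (4 * (q * (B * B)))) ⟩
        8 * (q * (B * d)) + 0                       ≡⟨ +-identityʳ _ ⟩
        8 * (q * (B * d))                           ≤⟨ small-cost d≤4 ⟩
        32 * (q * B)                                ≤⟨ *-monoˡ-≤ (q * B) (m≤m+n 32 18) ⟩
        50 * (q * B)                                ≤⟨ qB≤ ⟩
        p * (B * B)                                 ≤⟨ m≤m+n _ _ ⟩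
        2 * (p * (B * B))                           ≡⟨ *-identityʳ _ ⟨
        2 * (p * (B * B)) * 1                       ≤⟨ m≤n+m _ _ ⟩
        16 * (q * (x * x)) + q * (B * B) * 0 + 2 * (p * (B * B)) * 1  ∎

      -- A singleton class has degree 0 and costs nothing. With at most 4 classmates the degree is
      -- at most 4, and the cost is absorbed by `qB≤`. From 5 on, 8Bx ≤ 16x² + B², where B² is the
      -- credit for a large class.
      lone : ∀ e {d} → d ≤ x → d ≤ e → cost d 0 ≤ credit x e 0
      lone 0 _ z≤n rewrite *-zeroʳ B | *-zeroʳ q | *-zeroʳ (4 * (q * (B * B))) = z≤n
      lone 1 _ d≤e = small 1 (≤-trans d≤e (m≤m+n 1 3)) refl refl
      lone 2 _ d≤e = small 2 (≤-trans d≤e (m≤m+n 2 2)) refl refl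
      lone 3 _ d≤e = small 3 (≤-trans d≤e (m≤m+n 3 1)) refl refl
      lone 4 _ d≤e = small 4 d≤e refl refl
      lone (suc (suc (suc (suc (suc e))))) {d} d≤x _ = begin
        8 * (q * (B * d)) + 4 * (q * (B * B)) * 0   ≡⟨ cong (8 * (q * (B * d)) +_) (*-zeroʳ (4 * (q * (B * B)))) ⟩
        8 * (q * (B * d)) + 0                       ≡⟨ +-identityʳ _ ⟩
        8 * (q * (B * d))                           ≤⟨ *-monoʳ-≤ 8 (*-monoʳ-≤ q (*-monoʳ-≤ B d≤x)) ⟩
        8 * (q * (B * x))                           ≡⟨ lhs q B x ⟩
        q * (2 * (4 * x * B))                       ≤⟨ *-monoʳ-≤ q (am-gm (4 * x) B) ⟩
        q * (4 * x * (4 * x) + B * B)               ≡⟨ rhs q B x ⟩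
        16 * (q * (x * x)) + q * (B * B) * 1        ≤⟨ m≤m+n _ _ ⟩
        16 * (q * (x * x)) + q * (B * B) * 1 + 2 * (p * (B * B)) * 1  ∎
        where
        lhs : ∀ q B x → 8 * (q * (B * x)) ≡ q * (2 * (4 * x * B))
        lhs = solve-∀
        rhs : ∀ q B x → q * (4 * x * (4 * x) + B * B) ≡ 16 * (q * (x * x)) + q * (B * B) * 1
        rhs = solve-∀

    open Lone using (lone) public

    module Pair (x y : ℕ) (b≤x+y : b ≤ x + y) where

      open ≤-Reasoning

      a s t P u : ℕ
      a = q * (B * B)
      s = q * (x * x + y * y)
      t = q * (B * (x + y))
      P = p * (B * B)
      u = q * B

      degree-sum : 10 * a ≤ 10 * t + P
      degree-sum = begin
        10 * (q * (B * B))                          ≡⟨ lhs q B ⟩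
        10 * (q * B) * B                            ≤⟨ *-monoˡ-≤ B b≥ ⟩
        (10 * (q * b) + p * B) * B
          ≤⟨ *-monoˡ-≤ B (+-monoˡ-≤ (p * B) (*-monoʳ-≤ 10 (*-monoʳ-≤ q b≤x+y))) ⟩
        (10 * (q * (x + y)) + p * B) * B            ≡⟨ rhs q B p (x + y) ⟩
        10 * (q * (B * (x + y))) + p * (B * B)      ∎
        where
        lhs : ∀ q B → 10 * (q * (B * B)) ≡ 10 * (q * B) * B
        lhs = solve-∀
        rhs : ∀ q B p z → (10 * (q * z) + p * B) * B ≡ 10 * (q * (B * z)) + p * (B * B)
        rhs = solve-∀

      -- The tangent to 16 (x² + y²) at x = y = B/2.
      tangent-half : 16 * t ≤ 16 * s + 8 * a
      tangent-half = begin
        16 * (q * (B * (x + y)))                                                 ≡⟨ lhs q B x y ⟩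
        q * (2 * (4 * x * (2 * B)) + 2 * (4 * y * (2 * B)))
          ≤⟨ *-monoʳ-≤ q (+-mono-≤ (am-gm (4 * x) (2 * B)) (am-gm (4 * y) (2 * B))) ⟩
        q * (4 * x * (4 * x) + 2 * B * (2 * B) + (4 * y * (4 * y) + 2 * B * (2 * B)))  ≡⟨ rhs q B x y ⟩
        16 * (q * (x * x + y * y)) + 8 * (q * (B * B))                           ∎
        where
        lhs : ∀ q B x y → 16 * (q * (B * (x + y))) ≡ q * (2 * (4 * x * (2 * B)) + 2 * (4 * y * (2 * B)))
        lhs = solve-∀
        rhs : ∀ q B x y → q * (4 * x * (4 * x) + 2 * B * (2 * B) + (4 * y * (4 * y) + 2 * B * (2 * B)))
                          ≡ 16 * (q * (x * x + y * y)) + 8 * (q * (B * B))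
        rhs = solve-∀

      -- The tangent to 64 (x² + y²) − 32 B y at (x , y) = (3B/8 , 5B/8), where it is minimal on x + y = B.
      tangent-skew : 48 * t + 32 * (q * (B * y)) ≤ 64 * s + 34 * a
      tangent-skew = begin
        48 * (q * (B * (x + y))) + 32 * (q * (B * y))                            ≡⟨ lhs q B x y ⟩
        q * (2 * (8 * x * (3 * B)) + 2 * (8 * y * (5 * B)))
          ≤⟨ *-monoʳ-≤ q (+-mono-≤ (am-gm (8 * x) (3 * B)) (am-gm (8 * y) (5 * B))) ⟩
        q * (8 * x * (8 * x) + 3 * B * (3 * B) + (8 * y * (8 * y) + 5 * B * (5 * B)))  ≡⟨ rhs q B x y ⟩
        64 * (q * (x * x + y * y)) + 34 * (q * (B * B))                          ∎
        where
        lhs : ∀ q B x y → 48 * (q * (B * (x + y))) + 32 * (q * (B * y)) ≡ q * (2 * (8 * x * (3 * B)) + 2 * (8 * y * (5 * B)))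
        lhs = solve-∀
        rhs : ∀ q B x y → q * (8 * x * (8 * x) + 3 * B * (3 * B) + (8 * y * (8 * y) + 5 * B * (5 * B)))
                          ≡ 64 * (q * (x * x + y * y)) + 34 * (q * (B * B))
        rhs = solve-∀

      -- The multipliers 8 and 5 give both inequalities the same 80t, which cancels.
      both-single : 8 * a ≤ 16 * s + 4 * P
      both-single = *-cancelˡ-≤ 5 (+-cancelʳ-≤ (40 * a + 80 * t) _ _ (begin
        5 * (8 * a) + (40 * a + 80 * t)                       ≡⟨ lhs a t ⟩
        8 * (10 * a) + 5 * (16 * t)
          ≤⟨ +-mono-≤ (*-monoʳ-≤ 8 degree-sum) (*-monoʳ-≤ 5 tangent-half) ⟩
        8 * (10 * t + P) + 5 * (16 * s + 8 * a)               ≤⟨ m≤m+n _ (12 * P) ⟩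
        8 * (10 * t + P) + 5 * (16 * s + 8 * a) + 12 * P      ≡⟨ rhs a s t P ⟩
        5 * (16 * s + 4 * P) + (40 * a + 80 * t)              ∎))
        where
        lhs : ∀ a t → 5 * (8 * a) + (40 * a + 80 * t) ≡ 8 * (10 * a) + 5 * (16 * t)
        lhs = solve-∀
        rhs : ∀ a s t P → 8 * (10 * t + P) + 5 * (16 * s + 8 * a) + 12 * P ≡ 5 * (16 * s + 4 * P) + (40 * a + 80 * t)
        rhs = solve-∀

      -- The combination of `both-single` leaves 4a to spare, so the linear term can be paid by
      -- `qB≤`.
      single-small : 4 * a + 32 * u ≤ 16 * s + 4 * P
      single-small = *-cancelˡ-≤ 5 (+-cancelʳ-≤ (60 * a + 80 * t + 40 * u) _ _ (begin
        5 * (4 * a + 32 * u) + (60 * a + 80 * t + 40 * u)                   ≡⟨ lhs a t u ⟩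
        8 * (10 * a) + 5 * (16 * t) + 4 * (50 * u)
          ≤⟨ +-mono-≤ (+-mono-≤ (*-monoʳ-≤ 8 degree-sum) (*-monoʳ-≤ 5 tangent-half)) (*-monoʳ-≤ 4 qB≤) ⟩
        8 * (10 * t + P) + 5 * (16 * s + 8 * a) + 4 * P                     ≤⟨ m≤m+n _ (8 * P + 20 * a + 40 * u) ⟩
        8 * (10 * t + P) + 5 * (16 * s + 8 * a) + 4 * P + (8 * P + 20 * a + 40 * u)  ≡⟨ rhs a s t P u ⟩
        5 * (16 * s + 4 * P) + (60 * a + 80 * t + 40 * u)                   ∎))
        where
        lhs : ∀ a t u → 5 * (4 * a + 32 * u) + (60 * a + 80 * t + 40 * u) ≡ 8 * (10 * a) + 5 * (16 * t) + 4 * (50 * u)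
        lhs = solve-∀
        rhs : ∀ a s t P u → 8 * (10 * t + P) + 5 * (16 * s + 8 * a) + 4 * P + (8 * P + 20 * a + 40 * u)
              ≡ 5 * (16 * s + 4 * P) + (60 * a + 80 * t + 40 * u)
        rhs = solve-∀

      -- The multipliers 5 and 24 make the terms 240t cancel. After division by 20 this leaves 3.5a
      -- on the left, where 4a - a = 3a is required.
      single-large : 4 * a + 8 * (q * (B * y)) ≤ 16 * s + a + 4 * P
      single-large = *-cancelˡ-≤ 20 (+-cancelʳ-≤ (240 * t + 160 * a) _ _ (begin
        20 * (4 * a + 8 * v) + (240 * t + 160 * a)                          ≡⟨ lhs a t v ⟩
        5 * (48 * t + 32 * v) + 24 * (10 * a)
          ≤⟨ +-mono-≤ (*-monoʳ-≤ 5 tangent-skew) (*-monoʳ-≤ 24 degree-sum) ⟩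
        5 * (64 * s + 34 * a) + 24 * (10 * t + P)                           ≤⟨ m≤m+n _ (10 * a + 56 * P) ⟩
        5 * (64 * s + 34 * a) + 24 * (10 * t + P) + (10 * a + 56 * P)       ≡⟨ rhs a s t P ⟩
        20 * (16 * s + a + 4 * P) + (240 * t + 160 * a)                     ∎))
        where
        v = q * (B * y)
        lhs : ∀ a t v → 20 * (4 * a + 8 * v) + (240 * t + 160 * a) ≡ 5 * (48 * t + 32 * v) + 24 * (10 * a)
        lhs = solve-∀
        rhs : ∀ a s t P → 5 * (64 * s + 34 * a) + 24 * (10 * t + P) + (10 * a + 56 * P)
              ≡ 20 * (16 * s + a + 4 * P) + (240 * t + 160 * a)
        rhs = solve-∀

      cost-split : ∀ d → cost 0 1 + cost d 0 ≡ 4 * a + 8 * (q * (B * d))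
      cost-split d = identity q B d
        where
        identity : ∀ q B d → 8 * (q * (B * 0)) + 4 * (q * (B * B)) * 1 + (8 * (q * (B * d)) + 4 * (q * (B * B)) * 0)
                             ≡ 4 * (q * (B * B)) + 8 * (q * (B * d))
        identity = solve-∀

      small : ∀ e {d} → d ≤ 4 → large e ≡ 0 → nontrivial e ≡ 1 → cost 0 1 + cost d 0 ≤ credit x 0 1 + credit y e 0
      small e {d} d≤4 l≡0 t≡1 rewrite l≡0 | t≡1 = begin
        cost 0 1 + cost d 0                                 ≡⟨ cost-split d ⟩
        4 * a + 8 * (q * (B * d))                     ≤⟨ +-monoʳ-≤ (4 * a) (small-cost d≤4) ⟩
        4 * a + 32 * u                                ≤⟨ single-small ⟩
        16 * s + 4 * P                                ≡⟨ identity q p B x y ⟩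
        _                                             ∎
        where
        identity : ∀ q p B x y → 16 * (q * (x * x + y * y)) + 4 * (p * (B * B)) ≡
          16 * (q * (x * x)) + q * (B * B) * 0 + 2 * (p * (B * B)) * 1 + (16 * (q * (y * y)) + q * (B * B) * 0 + 2 * (p * (B * B)) * 1)
        identity = solve-∀

      -- The first vertex is in S. Its partner is in S exactly when its class is a singleton, hence
      -- the indicator `1 ∸ nontrivial e`; in every case both ends earn the error credit, 4P
      -- together.
      pair : ∀ e {d} → d ≤ y → d ≤ e → cost 0 1 + cost d (1 ∸ nontrivial e) ≤ credit x 0 1 + credit y e (1 ∸ nontrivial e)
      pair 0 _ z≤n = begin
        cost 0 1 + cost 0 1     ≡⟨ lhs q B ⟩
        8 * a             ≤⟨ both-single ⟩
        16 * s + 4 * P    ≡⟨ rhs q p B x y ⟩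
        credit x 0 1 + credit y 0 1 ∎
        where
        lhs : ∀ q B → 8 * (q * (B * 0)) + 4 * (q * (B * B)) * 1 + (8 * (q * (B * 0)) + 4 * (q * (B * B)) * 1)
                      ≡ 8 * (q * (B * B))
        lhs = solve-∀
        rhs : ∀ q p B x y → 16 * (q * (x * x + y * y)) + 4 * (p * (B * B)) ≡
          16 * (q * (x * x)) + q * (B * B) * 0 + 2 * (p * (B * B)) * 1 + (16 * (q * (y * y)) + q * (B * B) * 0 + 2 * (p * (B * B)) * 1)
        rhs = solve-∀
      pair 1 _ d≤e = small 1 (≤-trans d≤e (m≤m+n 1 3)) refl refl
      pair 2 _ d≤e = small 2 (≤-trans d≤e (m≤m+n 2 2)) refl refl
      pair 3 _ d≤e = small 3 (≤-trans d≤e (m≤m+n 3 1)) refl refl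
      pair 4 _ d≤e = small 4 d≤e refl refl
      pair (suc (suc (suc (suc (suc e))))) {d} d≤y _ = begin
        cost 0 1 + cost d 0                                 ≡⟨ cost-split d ⟩
        4 * a + 8 * (q * (B * d))
          ≤⟨ +-monoʳ-≤ (4 * a) (*-monoʳ-≤ 8 (*-monoʳ-≤ q (*-monoʳ-≤ B d≤y))) ⟩
        4 * a + 8 * (q * (B * y))                     ≤⟨ single-large ⟩
        16 * s + a + 4 * P                            ≡⟨ identity q p B x y ⟩
        _                                             ∎
        where
        identity : ∀ q p B x y → 16 * (q * (x * x + y * y)) + q * (B * B) + 4 * (p * (B * B)) ≡
          16 * (q * (x * x)) + q * (B * B) * 0 + 2 * (p * (B * B)) * 1 + (16 * (q * (y * y)) + q * (B * B) * 1 + 2 * (p * (B * B)) * 1)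
        identity = solve-∀

    open Pair using (pair) public

  -- Global counting

  -- All that the counting uses of the barrier and its classes.
  record Decomposition (H : Graph n) (μ : ℕ) : Set where
    field
      A          : Fin n → Bool
      k          : ℕ
      classmates : Fin n → ℕ
      count      : ∣ A ∣ + k ≡ μ
      deg≤       : ∀ v → deg (H ∖ A) v ≤ classmates v
      demand≤    : sum (λ v → demand (classmates v)) ≤ 12 * k

  barrier⇒decomposition : {H : Graph n} {μ : ℕ} → Barrier H μ → ¬ ¬ Decomposition H μ
  barrier⇒decomposition {H = H} {μ} barrier continue =
    ¬¬-∀Fin (λ u → ¬¬-∀Fin (λ v → ¬¬-excluded-middle)) λ missBoth? → continue (decomposition missBoth?)
    where
    open Barrier barrier
    open Gallai (H ∖ A) (2 * k) maximum missed
    decomposition : (∀ u v → Dec (MissBoth u v)) → Decomposition H μ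
    decomposition missBoth? = record
      { A = A ; k = k ; classmates = Classes.others missBoth? ; count = count
      ; deg≤ = Classes.deg≤others missBoth?
      ; demand≤ = ≤-trans
          (sum-demand-others (H ∖ A) (2 * k) maximum missed missBoth? (proj₁ witness) (proj₂ witness))
          (≤-reflexive (≡.sym (*-assoc 6 2 k))) }

  decompose : (H : Graph n) (μ : ℕ) → IsMaxMatchingSize H μ → ¬ ¬ Decomposition H μ
  decompose {n} H μ ((L , isM , refl) , maximal) continue =
    extend-barrier H μ ∅ maximum₀ M₀ (proj₂ (fromList L isM)) λ barrier →
    barrier⇒decomposition (subst (Barrier H) (cong (_+ length L) ∣∅∣≡0) barrier) continue
    where
    ∅ : Fin n → Bool
    ∅ _ = false
    ∣∅∣≡0 : ∣ ∅ ∣ ≡ 0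
    ∣∅∣≡0 = sum-zero (λ v → 𝟙 (∅ v)) (λ _ → refl)
    M₀ : Matching (H ∖ ∅)
    M₀ .mate         = mate (proj₁ (fromList {K = H} L isM))
    M₀ .involutive   = involutive (proj₁ (fromList {K = H} L isM))
    M₀ .edge v p     = ∖-adj⁺ H ∅ (edge (proj₁ (fromList {K = H} L isM)) v p) refl refl
    maximum₀ : (M : Matching (H ∖ ∅)) → size M ≤ 2 * μ
    maximum₀ M = let L′ , (edges , unique) , eq = toList M in
      ≤-trans (≤-reflexive eq) (*-monoʳ-≤ 2 (maximal L′ (All.map (λ p → proj₁ (∖-adj⁻ H ∅ p)) edges , unique)))

  module Counting (p q B b : ℕ) .{{_ : NonZero B}}
    (B≥50/ε : 50 * q ≤ p * B) (b≥ : 10 * (q * B) ≤ 10 * (q * b) + p * B)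
    (G H : Graph n) (edcs : IsEDCS G H B b) (μ : ℕ) (dec : Decomposition H μ) (m : Matching G) where

    open Decomposition dec
    open OutsideDegrees H B (proj₁ (proj₂ edcs)) A using (inside; D; d′; d′≤D; sum-D²)
    open Potential p q B b B≥50/ε b≥

    W S : Fin n → ℕ
    W v = 𝟙 (not (A v) ∧ (not (A (mate m v)) ∧ not (does (mate m v ≟ v))))
    S v = W v * (1 ∸ nontrivial (classmates v))

    W-inv : ∀ v → W v ≢ 0 → A v ≡ false × A (mate m v) ≡ false × mate m v ≢ v
    W-inv v p with A v | A (mate m v) | mate m v ≟ v
    ... | true  | _     | _     = contradiction refl p
    ... | false | true  | _     = contradiction refl p
    ... | false | false | yes _ = contradiction refl p
    ... | false | false | no q  = refl , refl , q

    W-yes : ∀ v → A v ≡ false → A (mate m v) ≡ false → mate m v ≢ v → W v ≡ 1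
    W-yes v p q r rewrite p | q with mate m v ≟ v
    ... | yes s = contradiction s r
    ... | no _  = refl

    costAt creditAt : Fin n → ℕ
    costAt v = cost (d′ v) (S v)
    creditAt v = credit (D v) (classmates v) (S v)

    D-outside : ∀ {v} → A v ≡ false → D v ≡ deg H v
    D-outside p rewrite p = *-identityˡ _

    lone-vertex : ∀ v → S v ≡ 0 → costAt v ≤ creditAt v
    lone-vertex v p = subst (λ s → cost (d′ v) s ≤ credit (D v) (classmates v) s) (≡.sym p)
      (lone (D v) (classmates v) (d′≤D v) (deg≤ v))

    -- A vertex of S has a singleton class and so no edge in `H ∖ A`. Its matching edge joins two
    -- vertices outside `A` and is therefore not in `H`, so P2 yields the degree sum that `pair`
    -- needs.
    matched-pair : ∀ v → S v ≢ 0 → costAt v + costAt (mate m v) ≤ creditAt v + creditAt (mate m v)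
    matched-pair v Sv = result (classmates v) refl
      where
      w = mate m v
      Wv : W v ≢ 0
      Wv p = Sv (cong (_* (1 ∸ nontrivial (classmates v))) p)
      Av = proj₁ (W-inv v Wv)
      Aw = proj₁ (proj₂ (W-inv v Wv))
      w≢v = proj₂ (proj₂ (W-inv v Wv))
      Ww : W w ≡ 1
      Ww = W-yes w Aw (≡.trans (cong A (involutive m v)) Av) (mate-covered m w≢v)
      Sw : S w ≡ 1 ∸ nontrivial (classmates w)
      Sw = ≡.trans (cong (_* (1 ∸ nontrivial (classmates w))) Ww) (*-identityˡ _)
      result : ∀ e → classmates v ≡ e → costAt v + costAt w ≤ creditAt v + creditAt w
      result (suc _) eq = contradiction
        (≡.trans (cong (λ e → W v * (1 ∸ nontrivial e)) eq) (*-zeroʳ (W v))) Sv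
      result zero eq = assemble Sv≡1 d′v≡0 eq Sw
        where
        Sv≡1 : S v ≡ 1
        Sv≡1 = cong₂ (λ x e → x * (1 ∸ nontrivial e)) (W-yes v Av Aw w≢v) eq
        d′v≡0 : d′ v ≡ 0
        d′v≡0 = n≤0⇒n≡0 (≤-trans (deg≤ v) (≤-reflexive eq))
        not-in-H : adj H v w ≡ false
        not-in-H with adj H v w in vw
        ... | false = refl
        ... | true  = contradiction
          (≤-trans (≤-reflexive (≡.sym (cong 𝟙 (∖-adj⁺ H A vw Av Aw)))) (≤-trans
            (term≤sum (λ z → 𝟙 (adj (H ∖ A) v z)) w)
            (≤-reflexive (≡.trans (≡.sym (deg≡sum (H ∖ A) v)) d′v≡0))))
          λ ()
        b≤ : b ≤ D v + D w
        b≤ = ≤-trans (proj₂ (proj₂ edcs) v w (edge m v w≢v) not-in-H)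
          (≤-reflexive (≡.sym (cong₂ _+_ (D-outside Av) (D-outside Aw))))
        assemble : ∀ {s d e s′} → s ≡ 1 → d ≡ 0 → e ≡ 0 → s′ ≡ 1 ∸ nontrivial (classmates w) →
                   cost d s + cost (d′ w) s′ ≤ credit (D v) e s + credit (D w) (classmates w) s′
        assemble refl refl refl refl = pair (D v) (D w) b≤ (classmates w) (d′≤D w) (deg≤ w)

    pointwise : ∀ v → costAt v + costAt (mate m v) ≤ creditAt v + creditAt (mate m v)
    pointwise v with S v ℕ.≟ 0 | S (mate m v) ℕ.≟ 0
    ... | no Sv  | _      = matched-pair v Sv
    ... | yes Sv | yes Sw = +-mono-≤ (lone-vertex v Sv) (lone-vertex (mate m v) Sw)
    ... | yes _  | no Sw  = subst₂ _≤_ (+-comm _ (costAt v)) (+-comm _ (creditAt v))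
      (subst (λ z → costAt (mate m v) + costAt z ≤ creditAt (mate m v) + creditAt z) (involutive m v) (matched-pair (mate m v) Sw))

    -- Since `mate m` is a permutation, the inequality for each vertex with its partner counts every
    -- vertex twice; a missed vertex is paired with itself.
    sum-cost≤sum-credit : sum costAt ≤ sum creditAt
    sum-cost≤sum-credit = *-cancelˡ-≤ 2 (subst₂ _≤_ (doubled costAt) (doubled creditAt) (sum-mono pointwise))
      where
      doubled : ∀ f → sum (λ v → f v + f (mate m v)) ≡ 2 * sum f
      doubled f = ≡.trans (∑-distrib-+ f (f ∘ mate m))
        (cong (sum f +_) (≡.trans (sum-involution f (mate m) (involutive m)) (≡.sym (+-identityʳ _))))

    #S #N #L : ℕ
    #S = sum S
    #N = sum (λ v → nontrivial (classmates v))
    #L = sum (λ v → large (classmates v))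

    sum-cost : sum costAt ≡ 8 * (q * (B * sum d′)) + 4 * (q * (B * B)) * #S
    sum-cost = begin
      sum costAt
        ≡⟨ ∑-distrib-+ (λ v → 8 * (q * (B * d′ v))) (λ v → 4 * (q * (B * B)) * S v) ⟩
      sum (λ v → 8 * (q * (B * d′ v))) + sum (λ v → 4 * (q * (B * B)) * S v)
        ≡⟨ cong₂ _+_ (≡.trans (sum-*ˡ (λ v → q * (B * d′ v)) 8) (cong (8 *_)
             (≡.trans (sum-*ˡ (λ v → B * d′ v) q) (cong (q *_) (sum-*ˡ d′ B)))))
             (sum-*ˡ S (4 * (q * (B * B)))) ⟩
      8 * (q * (B * sum d′)) + 4 * (q * (B * B)) * #S ∎
      where open ≡.≡-Reasoning

    sum-credit : sum creditAt ≡ 16 * (q * sum (λ v → D v * D v)) + q * (B * B) * #L + 2 * (p * (B * B)) * (#S + #N)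
    sum-credit = begin
      sum creditAt
        ≡⟨ ∑-distrib-+ (λ v → 16 * (q * (D v * D v)) + q * (B * B) * large (classmates v))
                       (λ v → 2 * (p * (B * B)) * (S v + nontrivial (classmates v))) ⟩
      sum (λ v → 16 * (q * (D v * D v)) + q * (B * B) * large (classmates v))
        + sum (λ v → 2 * (p * (B * B)) * (S v + nontrivial (classmates v)))
        ≡⟨ cong₂ _+_
             (≡.trans (∑-distrib-+ (λ v → 16 * (q * (D v * D v))) (λ v → q * (B * B) * large (classmates v)))
               (cong₂ _+_
                 (≡.trans (sum-*ˡ (λ v → q * (D v * D v)) 16) (cong (16 *_) (sum-*ˡ (λ v → D v * D v) q)))
                 (sum-*ˡ (λ v → large (classmates v)) (q * (B * B)))))
             (≡.trans (sum-*ˡ (λ v → S v + nontrivial (classmates v)) (2 * (p * (B * B))))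
               (cong (2 * (p * (B * B)) *_) (∑-distrib-+ S (λ v → nontrivial (classmates v))))) ⟩
      16 * (q * sum (λ v → D v * D v)) + q * (B * B) * #L + 2 * (p * (B * B)) * (#S + #N) ∎
      where open ≡.≡-Reasoning

    -- The weight of d′ in `cost` is chosen so that, after `sum-D²` is inserted, the terms in the
    -- sum of d′ are equal on both sides. They cancel, and division by B² leaves the bound on |S|.
    singles-bound : 4 * (q * #S) ≤ 4 * (q * ∣ A ∣) + q * #L + 2 * (p * (#S + #N))
    singles-bound = *-cancelˡ-≤ (B * B) {{m*n≢0 B B}} (+-cancelʳ-≤ (8 * (q * (B * sum d′))) _ _ (begin
      B * B * (4 * (q * #S)) + 8 * (q * (B * sum d′))
        ≡⟨ lhs (B * B) q #S (8 * (q * (B * sum d′))) ⟩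
      8 * (q * (B * sum d′)) + 4 * (q * (B * B)) * #S
        ≡⟨ sum-cost ⟨
      sum costAt
        ≤⟨ sum-cost≤sum-credit ⟩
      sum creditAt
        ≡⟨ sum-credit ⟩
      16 * (q * sum (λ v → D v * D v)) + q * (B * B) * #L + 2 * (p * (B * B)) * (#S + #N)
        ≡⟨ cong (λ z → z + q * (B * B) * #L + 2 * (p * (B * B)) * (#S + #N)) (regroup q (sum (λ v → D v * D v))) ⟩
      4 * q * (4 * sum (λ v → D v * D v)) + q * (B * B) * #L + 2 * (p * (B * B)) * (#S + #N)
        ≤⟨ +-monoˡ-≤ (2 * (p * (B * B)) * (#S + #N)) (+-monoˡ-≤ (q * (B * B) * #L) (*-monoʳ-≤ (4 * q) sum-D²)) ⟩
      4 * q * (∣ A ∣ * (B * B) + 2 * (B * sum d′)) + q * (B * B) * #L + 2 * (p * (B * B)) * (#S + #N)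
        ≡⟨ rhs p q (B * B) (B * sum d′) ∣ A ∣ #L (#S + #N) ⟩
      B * B * (4 * (q * ∣ A ∣) + q * #L + 2 * (p * (#S + #N))) + 8 * (q * (B * sum d′)) ∎))
      where
      open ≤-Reasoning
      lhs : ∀ b q s z → b * (4 * (q * s)) + z ≡ z + 4 * (q * b) * s
      lhs = solve-∀
      regroup : ∀ q z → 16 * (q * z) ≡ 4 * q * (4 * z)
      regroup = solve-∀
      rhs : ∀ p q b d a l z → 4 * q * (a * b + 2 * d) + q * b * l + 2 * (p * b) * z
            ≡ b * (4 * (q * a) + q * l + 2 * (p * z)) + 8 * (q * d)
      rhs = solve-∀

    #S≤size : #S ≤ size m
    #S≤size = sum-mono λ v → bound v
      where
      bound : ∀ v → S v ≤ covered m v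
      bound v with mate m v ≟ v
      ... | yes Mv with A v | A (mate m v)
      ... | true  | _     = z≤n
      ... | false | true  = z≤n
      ... | false | false = z≤n
      bound v | no _ = *-mono-≤ (𝟙≤1 (not (A v) ∧ (not (A (mate m v)) ∧ true))) (m∸n≤m 1 (nontrivial (classmates v)))

    -- A covered vertex lies in `A`, or its partner does, or both are outside; in the last case its
    -- class is nontrivial or it belongs to S.
    size≤ : size m ≤ 2 * ∣ A ∣ + (#N + #S)
    size≤ = begin
      size m
        ≤⟨ sum-mono bound ⟩
      sum (λ v → inside v + inside (mate m v) + (nontrivial (classmates v) + S v))
        ≡⟨ ∑-distrib-+ (λ v → inside v + inside (mate m v)) (λ v → nontrivial (classmates v) + S v) ⟩
      sum (λ v → inside v + inside (mate m v)) + sum (λ v → nontrivial (classmates v) + S v)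
        ≡⟨ cong₂ _+_ (≡.trans (∑-distrib-+ inside (inside ∘ mate m))
             (cong (∣ A ∣ +_) (≡.trans (sum-involution inside (mate m) (involutive m)) (≡.sym (+-identityʳ _)))))
             (∑-distrib-+ (λ v → nontrivial (classmates v)) S) ⟩
      2 * ∣ A ∣ + (#N + #S) ∎
      where
      open ≤-Reasoning
      W≤ : ∀ w e → w ≤ 1 → w ≤ nontrivial e + w * (1 ∸ nontrivial e)
      W≤ w zero    _   = ≤-reflexive (≡.sym (*-identityʳ w))
      W≤ w (suc _) w≤1 = ≤-trans w≤1 (m≤m+n 1 _)
      covered≤ : ∀ v → covered m v ≤ inside v + inside (mate m v) + W v
      covered≤ v with A v | A (mate m v) | mate m v ≟ v
      ... | true  | _     | yes _ = z≤n
      ... | true  | _     | no _  = s≤s z≤n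
      ... | false | true  | yes _ = z≤n
      ... | false | true  | no _  = s≤s z≤n
      ... | false | false | yes _ = z≤n
      ... | false | false | no _  = s≤s z≤n
      bound : ∀ v → covered m v ≤ inside v + inside (mate m v) + (nontrivial (classmates v) + S v)
      bound v = ≤-trans (covered≤ v) (+-monoʳ-≤ (inside v + inside (mate m v))
        (W≤ (W v) (classmates v) (𝟙≤1 (not (A v) ∧ (not (A (mate m v)) ∧ not (does (mate m v ≟ v)))))))

    N+L≤ : 4 * #N + #L ≤ 12 * k
    N+L≤ = ≤-trans (≤-reflexive (≡.sym (≡.trans
      (∑-distrib-+ (λ v → 4 * nontrivial (classmates v)) (λ v → large (classmates v)))
      (cong (_+ #L) (sum-*ˡ (λ v → nontrivial (classmates v)) 4))))) demand≤

    -- Inserting the bound on 4q|S| turns 8|A| into 12|A| and 4|N| into 4|N| + |L|, which is at most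
    -- 12k; so the main term is 12q(|A| + k).
    matching-bound : ∀ μG → size m ≡ 2 * μG → μ ≤ μG → 2 * (q * μG) ≤ 3 * (q * μ) + 3 * (p * μG)
    matching-bound μG eq μ≤μG = *-cancelˡ-≤ 4 (begin
      4 * (2 * (q * μG))
        ≡⟨ i₁ q μG ⟩
      4 * q * (2 * μG)
        ≡⟨ cong (4 * q *_) eq ⟨
      4 * q * size m
        ≤⟨ *-monoʳ-≤ (4 * q) size≤ ⟩
      4 * q * (2 * ∣ A ∣ + (#N + #S))
        ≡⟨ i₂ q ∣ A ∣ #N #S ⟩
      8 * (q * ∣ A ∣) + 4 * (q * #N) + 4 * (q * #S)
        ≤⟨ +-monoʳ-≤ (8 * (q * ∣ A ∣) + 4 * (q * #N)) singles-bound ⟩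
      8 * (q * ∣ A ∣) + 4 * (q * #N) + (4 * (q * ∣ A ∣) + q * #L + 2 * (p * (#S + #N)))
        ≡⟨ i₃ p q ∣ A ∣ #N #L (#S + #N) ⟩
      12 * (q * ∣ A ∣) + q * (4 * #N + #L) + 2 * (p * (#S + #N))
        ≤⟨ +-mono-≤ (+-monoʳ-≤ (12 * (q * ∣ A ∣)) (*-monoʳ-≤ q N+L≤))
             (*-monoʳ-≤ 2 (*-monoʳ-≤ p (+-mono-≤ #S≤ #N≤))) ⟩
      12 * (q * ∣ A ∣) + q * (12 * k) + 2 * (p * (2 * μG + 3 * μG))
        -- The error of 10pμG is rounded up to 12pμG so that the factor 4 comes out.
        ≤⟨ m≤m+n _ (2 * (p * μG)) ⟩
      12 * (q * ∣ A ∣) + q * (12 * k) + 2 * (p * (2 * μG + 3 * μG)) + 2 * (p * μG)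
        ≡⟨ i₄ p q ∣ A ∣ k μG ⟩
      4 * (3 * (q * (∣ A ∣ + k)) + 3 * (p * μG))
        ≡⟨ cong (λ z → 4 * (3 * (q * z) + 3 * (p * μG))) count ⟩
      4 * (3 * (q * μ) + 3 * (p * μG)) ∎)
      where
      open ≤-Reasoning
      i₁ : ∀ q g → 4 * (2 * (q * g)) ≡ 4 * q * (2 * g)
      i₁ = solve-∀
      i₂ : ∀ q a n s → 4 * q * (2 * a + (n + s)) ≡ 8 * (q * a) + 4 * (q * n) + 4 * (q * s)
      i₂ = solve-∀
      i₃ : ∀ p q a n l z → 8 * (q * a) + 4 * (q * n) + (4 * (q * a) + q * l + 2 * (p * z))
           ≡ 12 * (q * a) + q * (4 * n + l) + 2 * (p * z)
      i₃ = solve-∀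
      i₄ : ∀ p q a k g → 12 * (q * a) + q * (12 * k) + 2 * (p * (2 * g + 3 * g)) + 2 * (p * g)
           ≡ 4 * (3 * (q * (a + k)) + 3 * (p * g))
      i₄ = solve-∀
      #S≤ : #S ≤ 2 * μG
      #S≤ = ≤-trans #S≤size (≤-reflexive eq)
      #N≤ : #N ≤ 3 * μG
      #N≤ = *-cancelˡ-≤ 4 (begin
        4 * #N            ≤⟨ m≤m+n _ #L ⟩
        4 * #N + #L       ≤⟨ N+L≤ ⟩
        12 * k            ≤⟨ *-monoʳ-≤ 12 (≤-trans (m≤n+m k ∣ A ∣) (≤-trans (≤-reflexive count) μ≤μG)) ⟩
        12 * μG           ≡⟨ *-assoc 4 3 μG ⟩
        4 * (3 * μG)      ∎)

  edcs-matching-bound : (p q B b : ℕ) .{{_ : NonZero B}} →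
    50 * q ≤ p * B → 10 * (q * B) ≤ 10 * (q * b) + p * B →
    (G H : Graph n) → IsEDCS G H B b →
    (μG μH : ℕ) → IsMaxMatchingSize G μG → IsMaxMatchingSize H μH →
    2 * (q * μG) ≤ 3 * (q * μH) + 3 * (p * μG)
  edcs-matching-bound p q B b B≥ b≥ G H edcs μG μH ((LG , isMG , refl) , maxG) maxH@((LH , (edges , unique) , refl) , _) =
    decidable-stable (2 * (q * μG) ≤? 3 * (q * μH) + 3 * (p * μG)) λ ¬bound →
    decompose H μH maxH λ dec →
    ¬bound (Counting.matching-bound p q B b B≥ b≥ G H edcs μH dec (proj₁ (fromList LG isMG)) μG
      (proj₂ (fromList LG isMG)) (maxG LH (All.map (proj₁ edcs _ _) edges , unique)))

open EDCS using (edcs-matching-bound)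

open import Data.Nat as ℕ using (ℕ; suc)
open import Data.Integer as ℤ using (+_)
open import Data.Rational using (ℚ; _/_; _÷_; _≤_; _<_; _*_; _-_; 0ℚ; 1ℚ; NonZero)
import Data.Integer.Properties as ℤ
open import Data.Integer.Tactic.RingSolver using (solve-∀)
open import Data.Nat.Coprimality using (Coprime)
open import Data.Rational as ℚ using (mkℚ; toℚᵘ; 1/_; -_)
import Data.Rational.Properties as ℚ
open import Data.Rational.Unnormalised as ℚᵘ using (mkℚᵘ; *≤*; _≃_)
import Data.Rational.Unnormalised.Properties as ℚᵘ

-- Clearing denominators, ε = p / q

toℚᵘ-ℕ : ∀ n → toℚᵘ (+ n / 1) ≃ mkℚᵘ (+ n) 0
toℚᵘ-ℕ n = ℚ.toℚᵘ-fromℚᵘ (mkℚᵘ (+ n) 0)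

toℚᵘ-minus : ∀ x y → toℚᵘ (x - y) ≃ toℚᵘ x ℚᵘ.- toℚᵘ y
toℚᵘ-minus x y = ℚᵘ.≃-trans (ℚ.toℚᵘ-homo-+ x (- y)) (ℚᵘ.+-congʳ (toℚᵘ x) (ℚ.toℚᵘ-homo‿- y))

-- For unnormalised rationals the order is cross-multiplication of integers, with no reduction to
-- lowest terms in the way.
clear-β : ∀ p-1 q-1 .(c : Coprime (suc p-1) (suc q-1)) β → let ε = mkℚ (+ suc p-1) q-1 c in
  (+ 50 / 1) ÷ ε ≤ (+ β / 1) → 50 ℕ.* suc q-1 ℕ.≤ suc p-1 ℕ.* β
clear-β p-1 q-1 c β h = ℤ.drop‿+≤+ (begin
  + (50 ℕ.* q)                      ≡⟨ ℤ.pos-* 50 q ⟩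
  + 50 ℤ.* + q                      ≡⟨ ℤ.*-identityʳ _ ⟨
  + 50 ℤ.* + q ℤ.* + 1              ≤⟨ ℚᵘ.drop-*≤* unnormalised ⟩
  + β ℤ.* + (1 ℕ.* p)               ≡⟨ cong (λ z → + β ℤ.* + z) (ℕ.*-identityˡ p) ⟩
  + β ℤ.* + p                       ≡⟨ ℤ.*-comm (+ β) (+ p) ⟩
  + p ℤ.* + β                       ≡⟨ ℤ.pos-* p β ⟨
  + (p ℕ.* β)                       ∎)
  where
  open ℤ.≤-Reasoning
  p = suc p-1
  q = suc q-1
  ε = mkℚ (+ p) q-1 c
  -- `mkℚᵘ` stores the denominator minus one, so the second factor is q/p, the inverse of ε.
  unnormalised : mkℚᵘ (+ 50) 0 ℚᵘ.* mkℚᵘ (+ q) p-1 ℚᵘ.≤ mkℚᵘ (+ β) 0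
  unnormalised = ℚᵘ.≤-respˡ-≃ (ℚ.toℚᵘ-homo-* (+ 50 / 1) (1/ ε))
    (ℚᵘ.≤-respʳ-≃ (toℚᵘ-ℕ β) (ℚ.toℚᵘ-mono-≤ h))

clear-β⁻ : ∀ p q-1 .(c : Coprime p (suc q-1)) β β⁻ → let ε = mkℚ (+ p) q-1 c in
  (1ℚ - ε * (+ 1 / 10)) * (+ β / 1) ≤ (+ β⁻ / 1) →
  10 ℕ.* (suc q-1 ℕ.* β) ℕ.≤ 10 ℕ.* (suc q-1 ℕ.* β⁻) ℕ.+ p ℕ.* β
clear-β⁻ p q-1 c β β⁻ h = ℤ.drop‿+≤+ (begin
  + (10 ℕ.* (q ℕ.* β))
    ≡⟨ ≡.trans (ℤ.pos-* 10 (q ℕ.* β)) (cong (+ 10 ℤ.*_) (ℤ.pos-* q β)) ⟩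
  + 10 ℤ.* (+ q ℤ.* + β)
    ≡⟨ lhs (+ p) (+ q) (+ β) ⟩
  -- The first summand has the unevaluated shape that cross-multiplication produces; adding pβ
  -- compensates for the subtracted ε/10.
  (+ 1 ℤ.* (+ q ℤ.* + 10) ℤ.+ ℤ.- (+ p ℤ.* + 1) ℤ.* + 1) ℤ.* + β ℤ.* + 1 ℤ.+ + p ℤ.* + β
    ≡⟨ cong (λ z → (+ 1 ℤ.* z ℤ.+ ℤ.- (+ p ℤ.* + 1) ℤ.* + 1) ℤ.* + β ℤ.* + 1 ℤ.+ + p ℤ.* + β) (ℤ.pos-* q 10) ⟨
  (+ 1 ℤ.* + (q ℕ.* 10) ℤ.+ ℤ.- (+ p ℤ.* + 1) ℤ.* + 1) ℤ.* + β ℤ.* + 1 ℤ.+ + p ℤ.* + β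
    ≤⟨ ℤ.+-monoˡ-≤ (+ p ℤ.* + β) (ℚᵘ.drop-*≤* unnormalised) ⟩
  + β⁻ ℤ.* + (1 ℕ.* (q ℕ.* 10) ℕ.* 1) ℤ.+ + p ℤ.* + β
    ≡⟨ cong (λ z → + β⁻ ℤ.* + z ℤ.+ + p ℤ.* + β) (≡.trans (ℕ.*-identityʳ (1 ℕ.* (q ℕ.* 10))) (ℕ.*-identityˡ (q ℕ.* 10))) ⟩
  + β⁻ ℤ.* + (q ℕ.* 10) ℤ.+ + p ℤ.* + β
    ≡⟨ cong (λ z → + β⁻ ℤ.* z ℤ.+ + p ℤ.* + β) (ℤ.pos-* q 10) ⟩
  + β⁻ ℤ.* (+ q ℤ.* + 10) ℤ.+ + p ℤ.* + β
    ≡⟨ rhs (+ p) (+ q) (+ β) (+ β⁻) ⟩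
  + 10 ℤ.* (+ q ℤ.* + β⁻) ℤ.+ + p ℤ.* + β
    ≡⟨ cong₂ ℤ._+_ (≡.trans (ℤ.pos-* 10 (q ℕ.* β⁻)) (cong (+ 10 ℤ.*_) (ℤ.pos-* q β⁻))) (ℤ.pos-* p β) ⟨
  + (10 ℕ.* (q ℕ.* β⁻) ℕ.+ p ℕ.* β) ∎)
  where
  open ℤ.≤-Reasoning
  q = suc q-1
  ε = mkℚ (+ p) q-1 c
  lhs : ∀ p q b → + 10 ℤ.* (q ℤ.* b)
        ≡ (+ 1 ℤ.* (q ℤ.* + 10) ℤ.+ ℤ.- (p ℤ.* + 1) ℤ.* + 1) ℤ.* b ℤ.* + 1 ℤ.+ p ℤ.* b
  lhs = solve-∀
  rhs : ∀ p q b b⁻ → b⁻ ℤ.* (q ℤ.* + 10) ℤ.+ p ℤ.* b ≡ + 10 ℤ.* (q ℤ.* b⁻) ℤ.+ p ℤ.* b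
  rhs = solve-∀
  unnormalised : (mkℚᵘ (+ 1) 0 ℚᵘ.- mkℚᵘ (+ p) q-1 ℚᵘ.* mkℚᵘ (+ 1) 9) ℚᵘ.* mkℚᵘ (+ β) 0 ℚᵘ.≤ mkℚᵘ (+ β⁻) 0
  unnormalised = ℚᵘ.≤-respˡ-≃
    (ℚᵘ.≃-trans (ℚ.toℚᵘ-homo-* (1ℚ - ε * (+ 1 / 10)) (+ β / 1)) (ℚᵘ.*-cong
      (ℚᵘ.≃-trans (toℚᵘ-minus 1ℚ (ε * (+ 1 / 10)))
        (ℚᵘ.+-congʳ (mkℚᵘ (+ 1) 0) (ℚᵘ.-‿cong (ℚ.toℚᵘ-homo-* ε (+ 1 / 10)))))
      (toℚᵘ-ℕ β)))
    (ℚᵘ.≤-respʳ-≃ (toℚᵘ-ℕ β⁻) (ℚ.toℚᵘ-mono-≤ h))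

restore-ε : ∀ p q-1 .(c : Coprime p (suc q-1)) μG μH → let ε = mkℚ (+ p) q-1 c in
  2 ℕ.* (suc q-1 ℕ.* μG) ℕ.≤ 3 ℕ.* (suc q-1 ℕ.* μH) ℕ.+ 3 ℕ.* (p ℕ.* μG) →
  ((+ 2 / 3) - ε) * (+ μG / 1) ≤ (+ μH / 1)
restore-ε p q-1 c μG μH h = ℚ.toℚᵘ-cancel-≤ (ℚᵘ.≤-respˡ-≃ (ℚᵘ.≃-sym
    (ℚᵘ.≃-trans (ℚ.toℚᵘ-homo-* ((+ 2 / 3) - ε) (+ μG / 1))
      (ℚᵘ.*-cong (toℚᵘ-minus (+ 2 / 3) ε) (toℚᵘ-ℕ μG))))
  (ℚᵘ.≤-respʳ-≃ (ℚᵘ.≃-sym (toℚᵘ-ℕ μH)) unnormalised))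
  where
  q = suc q-1
  ε = mkℚ (+ p) q-1 c
  integral : (+ 2 ℤ.* + q ℤ.+ ℤ.- + p ℤ.* + 3) ℤ.* + μG ℤ.* + 1 ℤ.≤ + μH ℤ.* + (3 ℕ.* q ℕ.* 1)
  integral = begin
    (+ 2 ℤ.* + q ℤ.+ ℤ.- + p ℤ.* + 3) ℤ.* + μG ℤ.* + 1
      ≡⟨ lhs (+ p) (+ q) (+ μG) ⟩
    + 2 ℤ.* (+ q ℤ.* + μG) ℤ.- + 3 ℤ.* (+ p ℤ.* + μG)
      ≡⟨ cong (ℤ._- (+ 3 ℤ.* (+ p ℤ.* + μG))) (triple 2 q μG) ⟨
    + (2 ℕ.* (q ℕ.* μG)) ℤ.- + 3 ℤ.* (+ p ℤ.* + μG)
      ≤⟨ ℤ.+-monoˡ-≤ (ℤ.- (+ 3 ℤ.* (+ p ℤ.* + μG))) (ℤ.+≤+ h) ⟩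
    + (3 ℕ.* (q ℕ.* μH)) ℤ.+ + (3 ℕ.* (p ℕ.* μG)) ℤ.- + 3 ℤ.* (+ p ℤ.* + μG)
      ≡⟨ cong₂ (λ x y → x ℤ.+ y ℤ.- + 3 ℤ.* (+ p ℤ.* + μG)) (triple 3 q μH) (triple 3 p μG) ⟩
    + 3 ℤ.* (+ q ℤ.* + μH) ℤ.+ + 3 ℤ.* (+ p ℤ.* + μG) ℤ.- + 3 ℤ.* (+ p ℤ.* + μG)
      ≡⟨ rhs (+ q) (+ μH) (+ 3 ℤ.* (+ p ℤ.* + μG)) ⟩
    + μH ℤ.* (+ 3 ℤ.* + q)
      ≡⟨ cong (+ μH ℤ.*_) (ℤ.pos-* 3 q) ⟨
    + μH ℤ.* + (3 ℕ.* q)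
      ≡⟨ cong (λ z → + μH ℤ.* + z) (ℕ.*-identityʳ (3 ℕ.* q)) ⟨
    + μH ℤ.* + (3 ℕ.* q ℕ.* 1) ∎
    where
    open ℤ.≤-Reasoning
    triple : ∀ x y z → + (x ℕ.* (y ℕ.* z)) ≡ + x ℤ.* (+ y ℤ.* + z)
    triple x y z = ≡.trans (ℤ.pos-* x (y ℕ.* z)) (cong (+ x ℤ.*_) (ℤ.pos-* y z))
    lhs : ∀ p q g → (+ 2 ℤ.* q ℤ.+ ℤ.- p ℤ.* + 3) ℤ.* g ℤ.* + 1 ≡ + 2 ℤ.* (q ℤ.* g) ℤ.- + 3 ℤ.* (p ℤ.* g)
    lhs = solve-∀
    rhs : ∀ q h z → + 3 ℤ.* (q ℤ.* h) ℤ.+ z ℤ.- z ≡ h ℤ.* (+ 3 ℤ.* q)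
    rhs = solve-∀
  unnormalised : (mkℚᵘ (+ 2) 2 ℚᵘ.- mkℚᵘ (+ p) q-1) ℚᵘ.* mkℚᵘ (+ μG) 0 ℚᵘ.≤ mkℚᵘ (+ μH) 0
  unnormalised = *≤* integral

theorem1p1 : (ε : ℚ) → .{{_ : NonZero ε}} → 0ℚ < ε → ε ≤ 1ℚ →
    (β β⁻ : ℕ) → β⁻ ℕ.< β → 1 ℕ.≤ β⁻ →
    (+ 50 / 1) ÷ ε ≤ (+ β / 1) →
    (1ℚ - ε * (+ 1 / 10)) * (+ β / 1) ≤ (+ β⁻ / 1) →
    {n : ℕ} (G H : Graph n) → IsEDCS G H β β⁻ →
    (μG μH : ℕ) → IsMaxMatchingSize G μG → IsMaxMatchingSize H μH →
    ((+ 2 / 3) - ε) * (+ μG / 1) ≤ (+ μH / 1)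
theorem1p1 (mkℚ (+ 0) _ _) (ℚ.*<* (ℤ.+<+ ()))
theorem1p1 (mkℚ ℤ.-[1+ _ ] _ _) (ℚ.*<* ())
-- Positivity of ε leaves only a positive numerator, and `β⁻ < β` only a successor for β, so that B²
-- can be cancelled.
theorem1p1 (mkℚ (+ suc p-1) q-1 c) _ _ β@(suc _) β⁻ _ _ hβ hβ⁻ G H edcs μG μH maxG maxH =
  restore-ε (suc p-1) q-1 c μG μH
    (edcs-matching-bound (suc p-1) (suc q-1) β β⁻
      (clear-β p-1 q-1 c β hβ) (clear-β⁻ (suc p-1) q-1 c β β⁻ hβ⁻) G H edcs μG μH maxG maxH)
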